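{- For any triangle-free graph $G$ with $\alpha(G)\geq\frac25$, we have $\beta(G)\leq\frac1{50}$.
   Context: All graphs are finite and simple. For a graph $G$ with $n\geq 1$ vertices, $\alpha(G)=\max\{|A|/n : A\subseteq V(G) \text{ an independent set}\}$ is the relative independence number. A half in $G$ is a function $\mu: V(G)\to[0,1]$ such that $\sum_{v\in V(G)}\mu(v)=n/2$. Put $\beta(G,\mu)=\frac1{n^2}\sum_{\{u,v\}\in E(G)}\mu(u)\mu(v)$ (each edge is counted once) and $\beta(G)=\min\{\beta(G,\mu): \mu \text{ is a half in } G\}$. -}

module Defs where

open import Data.Bool using (if_then_else_)
open import Data.Fin using (Fin; _<?_)
open import Data.Fin.Subset using (Subset; _∈_; ∣_∣)
open import Data.Integer using (+_)
open import Data.Nat as ℕ using (ℕ; NonZero)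
import Data.Nat.Properties as ℕ
open import Data.Product using (∃; _×_; _,_)
open import Data.Rational as ℚ using (ℚ; 0ℚ; 1ℚ; ½; _/_)
import Data.Rational.Properties as ℚ
open import Data.Rational.Solver using (module +-*-Solver)
open import Data.Vec.Functional using (Vector; foldr)
open import Level using (_⊔_; 0ℓ)
open import Relation.Binary.Core using (Rel)
open import Relation.Binary.Definitions using (Symmetric; Irreflexive; Decidable)
open import Relation.Binary.PropositionalEquality
  using (_≡_; refl; sym; trans; cong; cong₂)
open import Relation.Nullary using (¬_; does)
open import Relation.Nullary.Decidable using (_×-dec_)

-- Real numbers as Cauchy sequences of rationals.

Cauchy : (ℕ → ℚ) → Set
Cauchy s = ∀ ε → 0ℚ ℚ.< ε →
  ∃ λ N → ∀ m n → N ℕ.≤ m → N ℕ.≤ n → ℚ.∣ s m ℚ.- s n ∣ ℚ.≤ ε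

record ℝ : Set where
  constructor mkℝ
  field
    seq    : ℕ → ℚ
    cauchy : Cauchy seq

open ℝ public

infix 4 _≤ᴿ_ _≈ᴿ_

_≤ᴿ_ : Rel ℝ _
x ≤ᴿ y = ∀ ε → 0ℚ ℚ.< ε → ∃ λ N → ∀ n → N ℕ.≤ n → seq x n ℚ.≤ seq y n ℚ.+ ε

-- Equality of the real numbers represented.
_≈ᴿ_ : Rel ℝ _
x ≈ᴿ y = (x ≤ᴿ y) × (y ≤ᴿ x)

abstract

  const-cauchy : ∀ q → Cauchy (λ _ → q)
  const-cauchy q ε 0<ε = 0 , λ _ _ _ _ →
    ℚ.≤-trans (ℚ.≤-reflexive (cong ℚ.∣_∣ (ℚ.+-inverseʳ q))) (ℚ.<⇒≤ 0<ε)

fromℚ : ℚ → ℝ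
fromℚ q = mkℝ (λ _ → q) (const-cauchy q)

private

  open ℚ.≤-Reasoning

  ½+½ : ∀ ε → ε ℚ.* ½ ℚ.+ ε ℚ.* ½ ≡ ε
  ½+½ ε = trans (sym (ℚ.*-distribˡ-+ ε ½ ½)) (ℚ.*-identityʳ ε)

  half-pos : ∀ {ε} → 0ℚ ℚ.< ε → 0ℚ ℚ.< ε ℚ.* ½
  half-pos {ε} 0<ε =
    ℚ.positive⁻¹ _ {{ℚ.pos*pos⇒pos ε {{ℚ.positive 0<ε}} ½}}

  bounded : (x : ℝ) → ∃ λ B → ℚ.Positive B × ∃ λ N → ∀ n → N ℕ.≤ n → ℚ.∣ seq x n ∣ ℚ.≤ B
  bounded x with cauchy x 1ℚ (ℚ.positive⁻¹ 1ℚ)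
  ... | N , close = 1ℚ ℚ.+ ℚ.∣ seq x N ∣ , B-pos , N , bound
    where
    B-pos : ℚ.Positive (1ℚ ℚ.+ ℚ.∣ seq x N ∣)
    B-pos = ℚ.positive (ℚ.<-≤-trans (ℚ.positive⁻¹ 1ℚ)
      (ℚ.≤-trans (ℚ.≤-reflexive (sym (ℚ.+-identityʳ 1ℚ)))
                 (ℚ.+-monoʳ-≤ 1ℚ (ℚ.0≤∣p∣ (seq x N)))))

    bound : ∀ n → N ℕ.≤ n → ℚ.∣ seq x n ∣ ℚ.≤ 1ℚ ℚ.+ ℚ.∣ seq x N ∣
    bound n N≤n = begin
      ℚ.∣ seq x n ∣
        ≡⟨ cong ℚ.∣_∣ (lemma (seq x n) (seq x N)) ⟩
      ℚ.∣ (seq x n ℚ.- seq x N) ℚ.+ seq x N ∣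
        ≤⟨ ℚ.∣p+q∣≤∣p∣+∣q∣ (seq x n ℚ.- seq x N) (seq x N) ⟩
      ℚ.∣ seq x n ℚ.- seq x N ∣ ℚ.+ ℚ.∣ seq x N ∣
        ≤⟨ ℚ.+-monoˡ-≤ ℚ.∣ seq x N ∣ (close n N N≤n ℕ.≤-refl) ⟩
      1ℚ ℚ.+ ℚ.∣ seq x N ∣ ∎
      where
      lemma : ∀ a b → a ≡ (a ℚ.- b) ℚ.+ b
      lemma = solve 2 (λ a b → a := (a :- b) :+ b) refl
        where open +-*-Solver

  -- A positive δ with B * δ ≡ ε.
  divide : ∀ B → ℚ.Positive B → ∀ ε → 0ℚ ℚ.< ε → ∃ λ δ → 0ℚ ℚ.< δ × B ℚ.* δ ≡ ε
  divide B B>0 ε 0<ε = B⁻¹ ℚ.* ε , δ-pos ,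
      trans (sym (ℚ.*-assoc B B⁻¹ ε))
            (trans (cong (ℚ._* ε) (ℚ.*-inverseʳ B {{nz}})) (ℚ.*-identityˡ ε))
    where
    nz  = ℚ.pos⇒nonZero B {{B>0}}
    B⁻¹ = (ℚ.1/ B) {{nz}}
    δ-pos : 0ℚ ℚ.< B⁻¹ ℚ.* ε
    δ-pos = ℚ.positive⁻¹ _
      {{ℚ.pos*pos⇒pos B⁻¹ {{ℚ.1/pos⇒pos B {{B>0}}}} ε {{ℚ.positive 0<ε}}}}

  ∣*∣-bound : ∀ {p q B δ} → ℚ.Positive B → ℚ.∣ p ∣ ℚ.≤ B → ℚ.∣ q ∣ ℚ.≤ δ →
              ℚ.∣ p ℚ.* q ∣ ℚ.≤ B ℚ.* δ
  ∣*∣-bound {p} {q} {B} {δ} B>0 p≤B q≤δ = begin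
    ℚ.∣ p ℚ.* q ∣         ≡⟨ ℚ.∣p*q∣≡∣p∣*∣q∣ p q ⟩
    ℚ.∣ p ∣ ℚ.* ℚ.∣ q ∣   ≤⟨ ℚ.*-monoʳ-≤-nonNeg ℚ.∣ q ∣ {{ℚ.∣-∣-nonNeg q}} p≤B ⟩
    B ℚ.* ℚ.∣ q ∣         ≤⟨ ℚ.*-monoˡ-≤-nonNeg B {{ℚ.pos⇒nonNeg B {{B>0}}}} q≤δ ⟩
    B ℚ.* δ               ∎

abstract

  +-cauchy : ∀ x y → Cauchy (λ n → seq x n ℚ.+ seq y n)
  +-cauchy x y ε 0<ε =
    let M , closeˣ = cauchy x (ε ℚ.* ½) (half-pos 0<ε)
        N , closeʸ = cauchy y (ε ℚ.* ½) (half-pos 0<ε)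
    in M ℕ.⊔ N , λ m n m≥ n≥ → begin
      ℚ.∣ (seq x m ℚ.+ seq y m) ℚ.- (seq x n ℚ.+ seq y n) ∣
        ≡⟨ cong ℚ.∣_∣ (lemma (seq x m) (seq y m) (seq x n) (seq y n)) ⟩
      ℚ.∣ (seq x m ℚ.- seq x n) ℚ.+ (seq y m ℚ.- seq y n) ∣
        ≤⟨ ℚ.∣p+q∣≤∣p∣+∣q∣ (seq x m ℚ.- seq x n) (seq y m ℚ.- seq y n) ⟩
      ℚ.∣ seq x m ℚ.- seq x n ∣ ℚ.+ ℚ.∣ seq y m ℚ.- seq y n ∣
        ≤⟨ ℚ.+-mono-≤ (closeˣ m n (ℕ.m⊔n≤o⇒m≤o M N m≥) (ℕ.m⊔n≤o⇒m≤o M N n≥))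
                      (closeʸ m n (ℕ.m⊔n≤o⇒n≤o M N m≥) (ℕ.m⊔n≤o⇒n≤o M N n≥)) ⟩
      ε ℚ.* ½ ℚ.+ ε ℚ.* ½
        ≡⟨ ½+½ ε ⟩
      ε ∎
    where
    lemma : ∀ a b c d → (a ℚ.+ b) ℚ.- (c ℚ.+ d) ≡ (a ℚ.- c) ℚ.+ (b ℚ.- d)
    lemma = solve 4 (λ a b c d → (a :+ b) :- (c :+ d) := (a :- c) :+ (b :- d)) refl
      where open +-*-Solver

  *-cauchy : ∀ x y → Cauchy (λ n → seq x n ℚ.* seq y n)
  *-cauchy x y ε 0<ε =
    let A , A>0 , K , ∣x∣≤A    = bounded x
        B , B>0 , L , ∣y∣≤B    = bounded y
        δ , 0<δ , Aδ≡          = divide A A>0 (ε ℚ.* ½) (half-pos 0<ε)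
        η , 0<η , Bη≡          = divide B B>0 (ε ℚ.* ½) (half-pos 0<ε)
        M , closeʸ             = cauchy y δ 0<δ
        N , closeˣ             = cauchy x η 0<η
    in (K ℕ.⊔ L) ℕ.⊔ (M ℕ.⊔ N) , λ m n m≥ n≥ →
    let K⊔L≤m = ℕ.m⊔n≤o⇒m≤o (K ℕ.⊔ L) (M ℕ.⊔ N) m≥
        M⊔N≤m = ℕ.m⊔n≤o⇒n≤o (K ℕ.⊔ L) (M ℕ.⊔ N) m≥
        K⊔L≤n = ℕ.m⊔n≤o⇒m≤o (K ℕ.⊔ L) (M ℕ.⊔ N) n≥
        M⊔N≤n = ℕ.m⊔n≤o⇒n≤o (K ℕ.⊔ L) (M ℕ.⊔ N) n≥
        Δx    = seq x m ℚ.- seq x n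
        Δy    = seq y m ℚ.- seq y n
    in begin
      ℚ.∣ seq x m ℚ.* seq y m ℚ.- seq x n ℚ.* seq y n ∣
        ≡⟨ cong ℚ.∣_∣ (lemma (seq x m) (seq y m) (seq x n) (seq y n)) ⟩
      ℚ.∣ seq x m ℚ.* Δy ℚ.+ seq y n ℚ.* Δx ∣
        ≤⟨ ℚ.∣p+q∣≤∣p∣+∣q∣ (seq x m ℚ.* Δy) (seq y n ℚ.* Δx) ⟩
      ℚ.∣ seq x m ℚ.* Δy ∣ ℚ.+ ℚ.∣ seq y n ℚ.* Δx ∣
        ≤⟨ ℚ.+-mono-≤
             (∣*∣-bound A>0 (∣x∣≤A m (ℕ.m⊔n≤o⇒m≤o K L K⊔L≤m))
                (closeʸ m n (ℕ.m⊔n≤o⇒m≤o M N M⊔N≤m) (ℕ.m⊔n≤o⇒m≤o M N M⊔N≤n)))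
             (∣*∣-bound B>0 (∣y∣≤B n (ℕ.m⊔n≤o⇒n≤o K L K⊔L≤n))
                (closeˣ m n (ℕ.m⊔n≤o⇒n≤o M N M⊔N≤m) (ℕ.m⊔n≤o⇒n≤o M N M⊔N≤n))) ⟩
      A ℚ.* δ ℚ.+ B ℚ.* η
        ≡⟨ cong₂ ℚ._+_ Aδ≡ Bη≡ ⟩
      ε ℚ.* ½ ℚ.+ ε ℚ.* ½
        ≡⟨ ½+½ ε ⟩
      ε ∎
    where
    lemma : ∀ a b c d → a ℚ.* b ℚ.- c ℚ.* d ≡ a ℚ.* (b ℚ.- d) ℚ.+ d ℚ.* (a ℚ.- c)
    lemma = solve 4 (λ a b c d → a :* b :- c :* d := a :* (b :- d) :+ d :* (a :- c)) refl
      where open +-*-Solver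

infixl 6 _+ᴿ_
infixl 7 _*ᴿ_

_+ᴿ_ : ℝ → ℝ → ℝ
x +ᴿ y = mkℝ (λ n → seq x n ℚ.+ seq y n) (+-cauchy x y)

_*ᴿ_ : ℝ → ℝ → ℝ
x *ᴿ y = mkℝ (λ n → seq x n ℚ.* seq y n) (*-cauchy x y)

sumᴿ : ∀ {n} → Vector ℝ n → ℝ
sumᴿ = foldr _+ᴿ_ (fromℚ 0ℚ)

IsMaximum : ∀ {a ℓ p} {A : Set a} → Rel A ℓ → (A → Set p) → A → Set (a ⊔ ℓ ⊔ p)
IsMaximum _≤_ P m = P m × (∀ x → P x → x ≤ m)

IsMinimum : ∀ {a ℓ p} {A : Set a} → Rel A ℓ → (A → Set p) → A → Set (a ⊔ ℓ ⊔ p)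
IsMinimum _≤_ P m = P m × (∀ x → P x → m ≤ x)

-- Finite simple graphs on the vertex set Fin n.
record Graph (n : ℕ) : Set₁ where
  field
    Adj    : Rel (Fin n) 0ℓ
    symm   : Symmetric Adj
    irrefl : Irreflexive _≡_ Adj
    adj?   : Decidable Adj

open Graph public

TriangleFree : ∀ {n} → Graph n → Set
TriangleFree G = ∀ u v w → ¬ (Adj G u v × Adj G v w × Adj G u w)

Independent : ∀ {n} → Graph n → Subset n → Set
Independent G A = ∀ u v → u ∈ A → v ∈ A → ¬ Adj G u v

-- a = α(G)
IsRelIndependenceNumber : ∀ {n} .{{_ : NonZero n}} → Graph n → ℚ → Set
IsRelIndependenceNumber {n} G =
  IsMaximum ℚ._≤_ (λ q → ∃ λ (A : Subset n) → Independent G A × q ≡ + ∣ A ∣ / n)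

record IsHalf {n : ℕ} (μ : Vector ℝ n) : Set where
  field
    nonneg : ∀ v → fromℚ 0ℚ ≤ᴿ μ v
    ≤one   : ∀ v → μ v ≤ᴿ fromℚ 1ℚ
    total  : sumᴿ μ ≈ᴿ fromℚ (+ n / 2)

-- The sum of μ(u)μ(v) over edges; u < v selects each edge {u,v} exactly once.
edgeSum : ∀ {n} → Graph n → Vector ℝ n → ℝ
edgeSum G μ = sumᴿ λ u → sumᴿ λ v →
  if does (u <? v ×-dec adj? G u v) then μ u *ᴿ μ v else fromℚ 0ℚ

-- β(G,μ)
weight : ∀ {n} .{{_ : NonZero n}} → Graph n → Vector ℝ n → ℝ
weight {n} G μ = fromℚ ((+ 1 / (n ℕ.* n)) {{ℕ.m*n≢0 n n}}) *ᴿ edgeSum G μ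

-- b = β(G)
IsMinHalfDensity : ∀ {n} .{{_ : NonZero n}} → Graph n → ℝ → Set
IsMinHalfDensity {n} G =
  IsMinimum _≤ᴿ_ (λ x → ∃ λ (μ : Vector ℝ n) → IsHalf μ × x ≈ᴿ weight G μ)

{-# OPTIONS --safe #-}
-- Let A be a maximum independent set, k = |A|, and suppose n = 2k + g with g > 0 (otherwise some
-- half lives on A); the hypothesis gives 2g ≤ k.  All halves are doubled, so they take values in
-- {0,1,2} and have total n.  Take 2 on A and add ν of total g outside.  Adjacent vertices have
-- disjoint neighbourhoods in A, so the vertices with more than k/2 neighbours in A form an
-- independent set; by maximality at least g vertices outside A remain.  If some vertex has at
-- least g/2 neighbours among these, put ν there.  Otherwise the remaining graph has small degrees;
-- split it into low vertices (at most k/4 neighbours in A) and middle ones, and for p ∈ A load first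
-- the low vertices and the middle neighbours of p, then anything else.  Averaging over p ∈ A, where
-- a middle vertex with d neighbours in A contributes through (4d − k)(k − 2d) ≥ 0, shows that
-- some p works.
--
-- The minimum exists because along the exchange direction e_i − e_j the edge weight is concave (or
-- linear): every rational half can be rounded, without increasing its weight, until at most one
-- value is fractional, hence until all doubled values are integers.  So the minimum over the finitely
-- many doubled halves is a lower bound for all rational halves and, approximating, for all real ones.

module Submission where

open import Defs
open import Algebra.Bundles using (CommutativeRing; CommutativeSemiring)
import Algebra.Properties.Semiring.Sum as SemiringSum
open import Data.Bool using (true; false; if_then_else_; _∧_)
open import Data.Fin using (Fin; zero; suc; toℕ; fromℕ<; finToFun; funToFin)
import Data.Fin as Fin
import Data.Fin.Properties as Fin
open import Data.Fin.Subset using (Subset; _∈_; ∣_∣)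
open import Data.Fin.Subset.Properties using (_∈?_)
open import Data.Integer using (+_)
import Data.Integer as ℤ
import Data.Integer.Properties as ℤ
open import Data.List using (filter; allFin)
open import Data.List.Membership.Propositional.Properties using (∈-filter⁺; ∈-allFin)
import Data.List.Relation.Unary.All as All
open import Data.List.Relation.Unary.All.Properties using (all-filter)
open import Data.Nat using (ℕ; NonZero)
open import Data.Nat as ℕ using (zero; suc; z≤n; s≤s)
import Data.Nat.Coprimality as Coprime
import Data.Nat.Properties as ℕ
open import Data.Nat.Tactic.RingSolver using (solve-∀)
open import Data.Product using (∃; _×_)
open import Data.Product using (_,_; proj₁; proj₂)
open import Data.Rational using (ℚ; _/_; _≥_)
open import Data.Rational as ℚ using (0ℚ; 1ℚ; ½; mkℚ; toℚᵘ; *≤*)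
import Data.Rational.Properties as ℚ
open import Data.Rational.Solver using (module +-*-Solver)
open import Data.Rational.Unnormalised using (mkℚᵘ; *≡*)
import Data.Rational.Unnormalised.Properties as ℚᵘ
open import Data.Sum as Sum using (_⊎_; inj₁; inj₂; [_,_]′)
open import Data.Vec using (_∷_; [])
import Data.Vec as Vec
import Data.Vec.Properties as Vec
open import Data.Vec.Functional using (Vector)
open import Function using (_∘_)
open import Relation.Binary.Bundles using (DecTotalOrder)
open import Relation.Binary.PropositionalEquality
  using (_≡_; _≢_; _≗_; refl; sym; trans; cong; cong₂; subst; subst₂)
open import Relation.Nullary using (Dec; yes; no; does; contradiction)
open import Relation.Nullary.Decidable using (_×-dec_; ¬?; dec-true; dec-false)

open import Data.List.Extrema (DecTotalOrder.totalOrder ℚ.≤-decTotalOrder)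
  using (argmin; argmin-all; f[argmin]≤f[xs])

-- Bilinear forms over a commutative semiring.

module BilinearForm {c ℓ} (R : CommutativeSemiring c ℓ) {n : ℕ}
  (a : Fin n → Fin n → CommutativeSemiring.Carrier R) where

  private module R = CommutativeSemiring R
  open R using (Carrier; _+_; _*_; _≈_; 0#; 1#)
  open SemiringSum R.semiring
  open import Relation.Binary.Reasoning.Setoid R.setoid

  row : Vector Carrier n → Vector Carrier n
  row x u = sum λ v → a u v * x v

  -- A semiring is enough, so the same algebra serves natural-number counts and rational weights.
  -- When `a` is an adjacency matrix, `form x x` meets every edge in both orders and is therefore
  -- twice the edge sum.
  form : Vector Carrier n → Vector Carrier n → Carrier
  form x y = sum λ u → x u * row y u

  row-+ : ∀ x y u → row (λ v → x v + y v) u ≈ row x u + row y u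
  row-+ x y u = begin
    row (λ v → x v + y v) u                     ≈⟨ sum-cong-≋ (λ v → R.distribˡ (a u v) (x v) (y v)) ⟩
    sum (λ v → a u v * x v + a u v * y v)       ≈⟨ ∑-distrib-+ (λ v → a u v * x v) (λ v → a u v * y v) ⟩
    row x u + row y u                           ∎

  row-* : ∀ r x u → row (λ v → r * x v) u ≈ r * row x u
  row-* r x u = begin
    row (λ v → r * x v) u          ≈⟨ sum-cong-≋ (λ v → begin
      a u v * (r * x v)              ≈⟨ R.*-assoc _ _ _ ⟨
      (a u v * r) * x v              ≈⟨ R.*-congʳ (R.*-comm (a u v) r) ⟩
      (r * a u v) * x v              ≈⟨ R.*-assoc _ _ _ ⟩
      r * (a u v * x v)              ∎) ⟩
    sum (λ v → r * (a u v * x v))  ≈⟨ *-distribˡ-sum r (λ v → a u v * x v) ⟨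
    r * row x u                    ∎

  form-+ˡ : ∀ x y z → form (λ v → x v + y v) z ≈ form x z + form y z
  form-+ˡ x y z = begin
    form (λ v → x v + y v) z                         ≈⟨ sum-cong-≋ (λ u → R.distribʳ (row z u) (x u) (y u)) ⟩
    sum (λ u → x u * row z u + y u * row z u)        ≈⟨ ∑-distrib-+ (λ u → x u * row z u) (λ u → y u * row z u) ⟩
    form x z + form y z                              ∎

  form-+ʳ : ∀ x y z → form x (λ v → y v + z v) ≈ form x y + form x z
  form-+ʳ x y z = begin
    form x (λ v → y v + z v)                         ≈⟨ sum-cong-≋ (λ u → R.trans (R.*-congˡ (row-+ y z u)) (R.distribˡ (x u) (row y u) (row z u))) ⟩
    sum (λ u → x u * row y u + x u * row z u)        ≈⟨ ∑-distrib-+ (λ u → x u * row y u) (λ u → x u * row z u) ⟩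
    form x y + form x z                              ∎

  form-*ˡ : ∀ r x y → form (λ v → r * x v) y ≈ r * form x y
  form-*ˡ r x y = begin
    form (λ v → r * x v) y            ≈⟨ sum-cong-≋ (λ u → R.*-assoc r (x u) (row y u)) ⟩
    sum (λ u → r * (x u * row y u))   ≈⟨ *-distribˡ-sum r (λ u → x u * row y u) ⟨
    r * form x y                      ∎

  form-cong : ∀ {x y z w} → (∀ v → x v ≈ y v) → (∀ v → z v ≈ w v) → form x z ≈ form y w
  form-cong x≈y z≈w = sum-cong-≋ λ u →
    R.*-cong (x≈y u) (sum-cong-≋ λ v → R.*-congˡ (z≈w v))

  module _ (a-sym : ∀ u v → a u v ≈ a v u) where

    form-comm : ∀ x y → form x y ≈ form y x
    form-comm x y = begin
      form x y                                 ≈⟨ sum-cong-≋ (λ u → *-distribˡ-sum (x u) (λ v → a u v * y v)) ⟩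
      sum (λ u → sum λ v → x u * (a u v * y v))  ≈⟨ ∑-comm (λ u v → x u * (a u v * y v)) ⟩
      sum (λ v → sum λ u → x u * (a u v * y v))  ≈⟨ sum-cong-≋ (λ v → sum-cong-≋ λ u → swap u v) ⟩
      sum (λ v → sum λ u → y v * (a v u * x u))  ≈⟨ sum-cong-≋ (λ v → *-distribˡ-sum (y v) (λ u → a v u * x u)) ⟨
      form y x                                 ∎
      where
      swap : ∀ u v → x u * (a u v * y v) ≈ y v * (a v u * x u)
      swap u v = begin
        x u * (a u v * y v)   ≈⟨ R.*-assoc _ _ _ ⟨
        (x u * a u v) * y v   ≈⟨ R.*-comm _ _ ⟩
        y v * (x u * a u v)   ≈⟨ R.*-congˡ (R.*-comm _ _) ⟩
        y v * (a u v * x u)   ≈⟨ R.*-congˡ (R.*-congʳ (a-sym u v)) ⟩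
        y v * (a v u * x u)   ∎

    -- Free of subtraction, hence valid for counts. Costs are read off it for `2 χ + ν`, for an
    -- exchange step and for a constant raise of a vector.
    form-square : ∀ x y → form (λ v → x v + y v) (λ v → x v + y v)
                        ≈ (form x x + form y y) + (form y x + form y x)
    form-square x y = begin
      form xy xy                                          ≈⟨ form-+ˡ x y xy ⟩
      form x xy + form y xy                               ≈⟨ R.+-cong (form-+ʳ x x y) (form-+ʳ y x y) ⟩
      (form x x + form x y) + (form y x + form y y)       ≈⟨ R.+-congʳ (R.+-congˡ (form-comm x y)) ⟩
      (form x x + form y x) + (form y x + form y y)       ≈⟨ R.+-assoc _ _ _ ⟩
      form x x + (form y x + (form y x + form y y))       ≈⟨ R.+-congˡ (R.+-assoc _ _ _) ⟨
      form x x + ((form y x + form y x) + form y y)       ≈⟨ R.+-congˡ (R.+-comm _ _) ⟩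
      form x x + (form y y + (form y x + form y x))       ≈⟨ R.+-assoc _ _ _ ⟨
      (form x x + form y y) + (form y x + form y x)       ∎
      where
      xy = λ v → x v + y v

-- Indicators and finite sums of natural numbers.

indicator : ∀ {p} {P : Set p} → Dec P → ℕ
indicator P? = if does P? then 1 else 0

indicator≤1 : ∀ {p} {P : Set p} (P? : Dec P) → indicator P? ℕ.≤ 1
indicator≤1 (yes _) = s≤s z≤n
indicator≤1 (no _)  = z≤n

indicator-cong : ∀ {p q} {P : Set p} {Q : Set q} → (P → Q) → (Q → P) →
                 (P? : Dec P) (Q? : Dec Q) → indicator P? ≡ indicator Q?
indicator-cong P⇒Q Q⇒P (yes _) (yes _) = refl
indicator-cong P⇒Q Q⇒P (no _)  (no _)  = refl
indicator-cong P⇒Q Q⇒P (yes p) (no ¬q) = contradiction (P⇒Q p) ¬q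
indicator-cong P⇒Q Q⇒P (no ¬p) (yes q) = contradiction (Q⇒P q) ¬p

does-true : ∀ {p} {P : Set p} (P? : Dec P) → does P? ≡ true → P
does-true (yes p) _ = p

module ℕSum where
  open import Data.Nat using (_+_; _*_; _∸_; _⊓_; _≤_; _<_)
  open SemiringSum ℕ.+-*-semiring public

  sum-mono : ∀ {n} {f g : Vector ℕ n} → (∀ i → f i ≤ g i) → sum f ≤ sum g
  sum-mono {zero}  f≤g = z≤n
  sum-mono {suc n} f≤g = ℕ.+-mono-≤ (f≤g zero) (sum-mono (f≤g ∘ suc))

  sum≡0 : ∀ {n} {f : Vector ℕ n} → (∀ i → f i ≡ 0) → sum f ≡ 0
  sum≡0 {n} f≡0 = trans (sum-cong-≗ f≡0) (sum-replicate-zero n)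

  sum-ones : ∀ n → sum {n} (λ _ → 1) ≡ n
  sum-ones zero    = refl
  sum-ones (suc n) = cong suc (sum-ones n)

  -- Greedy: each index takes as much of the remaining demand as its capacity allows. The
  -- constructions below obtain their exact totals this way.
  fill : ∀ {n} g (h : Vector ℕ n) → g ≤ sum h → ∃ λ ν → (∀ i → ν i ≤ h i) × sum ν ≡ g
  fill {zero}  g h g≤ = (λ ()) , (λ ()) , sym (ℕ.n≤0⇒n≡0 g≤)
  fill {suc n} g h g≤ with fill (g ∸ h zero) (h ∘ suc) (ℕ.m≤n+o⇒m∸n≤o g (h zero) g≤)
  ... | ν , ν≤h , Σν = ν′ , ν′≤h , trans (cong (g ⊓ h zero ℕ.+_) Σν) (trans (cong (ℕ._+ (g ∸ h zero)) (ℕ.⊓-comm g (h zero))) (ℕ.m⊓n+n∸m≡n (h zero) g))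
    where
    ν′ : Vector ℕ (suc n)
    ν′ zero    = g ⊓ h zero
    ν′ (suc i) = ν i
    ν′≤h : ∀ i → ν′ i ≤ h i
    ν′≤h zero    = ℕ.m⊓n≤n g (h zero)
    ν′≤h (suc i) = ν≤h i

  -- Otherwise `r i + 1 ≤ l i` wherever `w i` is positive, and the two weighted sums would differ by
  -- at least `sum w` in the wrong direction.
  weighted-pigeonhole : ∀ {n} (w l r : Vector ℕ n) → 0 < sum w →
    sum (λ i → w i * l i) ≤ sum (λ i → w i * r i) → ∃ λ i → 0 < w i × l i ≤ r i
  weighted-pigeonhole w l r 0<w wl≤wr with Fin.any? (λ i → 0 ℕ.<? w i ×-dec l i ℕ.≤? r i)
  ... | yes p = p
  ... | no ¬p = contradiction (begin-strict
      sum (λ i → w i * r i)           <⟨ ℕ.m<m+n _ 0<w ⟩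
      sum (λ i → w i * r i) + sum w   ≡⟨ ∑-distrib-+ (λ i → w i * r i) w ⟨
      sum (λ i → w i * r i + w i)     ≤⟨ sum-mono step ⟩
      sum (λ i → w i * l i)           ≤⟨ wl≤wr ⟩
      sum (λ i → w i * r i)           ∎) (ℕ.<-irrefl refl)
    where
    open ℕ.≤-Reasoning
    step : ∀ i → w i * r i + w i ≤ w i * l i
    step i with w i in eq
    ... | zero  = z≤n
    ... | suc x = begin
      suc x * r i + suc x   ≡⟨ trans (ℕ.+-comm _ (suc x)) (sym (ℕ.*-suc (suc x) (r i))) ⟩
      suc x * suc (r i)     ≤⟨ ℕ.*-monoʳ-≤ (suc x) (ℕ.≰⇒> λ l≤r →
                                ¬p (i , subst (0 <_) (sym eq) (s≤s z≤n) , l≤r)) ⟩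
      suc x * l i           ∎

  ∣∣≡sum : ∀ {n} (A : Subset n) → ∣ A ∣ ≡ sum (λ v → indicator (v ∈? A))
  ∣∣≡sum []          = refl
  ∣∣≡sum (true ∷ A)  = cong suc (∣∣≡sum A)
  ∣∣≡sum (false ∷ A) = ∣∣≡sum A

adjacency : ∀ {n} → Graph n → Fin n → Fin n → ℕ
adjacency G u v = indicator (adj? G u v)

adjacency-sym : ∀ {n} (G : Graph n) u v → adjacency G u v ≡ adjacency G v u
adjacency-sym G u v = indicator-cong (symm G) (symm G) (adj? G u v) (adj? G v u)

-- The combinatorial bound: a light doubled half around a maximum independent set.

module SparseHalf {n} (G : Graph n) (triangle-free : TriangleFree G)
  (A : Subset n) (A-independent : Independent G A)
  (A-maximum : ∀ S → Independent G S → ∣ S ∣ ℕ.≤ ∣ A ∣) where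

  open import Data.Nat using (_+_; _*_; _∸_; _⊓_; _≤_; _<_; _≤?_; _<?_)
  open ℕSum
  open BilinearForm ℕ.+-*-commutativeSemiring (adjacency G)
  open ℕ.≤-Reasoning

  private
    k = ∣ A ∣
    a = adjacency G
    a-sym = adjacency-sym G

  χ : Vector ℕ n
  χ v = indicator (v ∈? A)

  -- The degree into `A`: a row of the adjacency matrix against an indicator counts neighbours.
  d : Vector ℕ n
  d = row χ

  -- Independence of the support, in the disjunctive form that puts a zero factor into every term of
  -- `form x x`.
  IndependentSupport : Vector ℕ n → Set
  IndependentSupport x = ∀ {u v} → Adj G u v → x u ≡ 0 ⊎ x v ≡ 0

  independent⇒form≡0 : ∀ {x} → IndependentSupport x → form x x ≡ 0
  independent⇒form≡0 {x} van = sum≡0 λ u →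
    trans (*-distribˡ-sum (x u) (λ v → a u v * x v)) (sum≡0 (term u))
    where
    term : ∀ u v → x u * (a u v * x v) ≡ 0
    term u v with adj? G u v
    ... | no _ = ℕ.*-zeroʳ (x u)
    ... | yes uv with van uv
    ...   | inj₁ xu≡0 rewrite xu≡0 = refl
    ...   | inj₂ xv≡0 rewrite xv≡0 = ℕ.*-zeroʳ (x u)

  independent-≤ : ∀ {x} c y → (∀ v → x v ≤ c * y v) → IndependentSupport y → IndependentSupport x
  independent-≤ {x} c y x≤cy van {u} {v} uv with van uv
  ... | inj₁ yu≡0 = inj₁ (ℕ.n≤0⇒n≡0 (subst (x u ≤_) (trans (cong (c *_) yu≡0) (ℕ.*-zeroʳ c)) (x≤cy u)))
  ... | inj₂ yv≡0 = inj₂ (ℕ.n≤0⇒n≡0 (subst (x v ≤_) (trans (cong (c *_) yv≡0) (ℕ.*-zeroʳ c)) (x≤cy v)))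

  -- An edge inside the neighbourhood of `b` would close a triangle with `b`. The factor `w` selects
  -- a part of the neighbourhood.
  independent-neighbourhood : ∀ b (w : Vector ℕ n) → IndependentSupport (λ v → a b v * w v)
  independent-neighbourhood b w {u} {v} uv with adj? G b u | adj? G b v
  ... | no _   | _      = inj₁ refl
  ... | yes _  | no _   = inj₂ refl
  ... | yes bu | yes bv = contradiction (bu , uv , bv) (triangle-free b u v)

  independent-χ : IndependentSupport χ
  independent-χ {u} {v} uv with u ∈? A | v ∈? A
  ... | no _   | _      = inj₁ refl
  ... | yes _  | no _   = inj₂ refl
  ... | yes u∈ | yes v∈ = contradiction uv (A-independent u v u∈ v∈)

  -- A common neighbour would close a triangle on the edge, so no vertex of `A` is counted twice.
  d-disjoint : ∀ {u v} → Adj G u v → d u + d v ≤ k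
  d-disjoint {u} {v} uv = begin
    d u + d v                              ≡⟨ ∑-distrib-+ (λ w → a u w * χ w) (λ w → a v w * χ w) ⟨
    sum (λ w → a u w * χ w + a v w * χ w)  ≤⟨ sum-mono step ⟩
    sum χ                                  ≡⟨ ∣∣≡sum A ⟨
    k                                      ∎
    where
    step : ∀ w → a u w * χ w + a v w * χ w ≤ χ w
    step w with adj? G u w | adj? G v w
    ... | yes uw | yes vw = contradiction (uv , vw , uw) (triangle-free u v w)
    ... | yes _  | no _   = ℕ.≤-reflexive (trans (ℕ.+-identityʳ _) (ℕ.*-identityˡ _))
    ... | no _   | yes _  = ℕ.≤-reflexive (ℕ.*-identityˡ _)
    ... | no _   | no _   = z≤n

  d-inside : ∀ {b} → b ∈ A → d b ≡ 0
  d-inside {b} b∈A = sum≡0 step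
    where
    step : ∀ v → a b v * χ v ≡ 0
    step v with adj? G b v | v ∈? A
    ... | no _   | _      = refl
    ... | yes _  | no _   = refl
    ... | yes bv | yes v∈ = contradiction bv (A-independent b v b∈A v∈)

  -- The indices are the indicators of A and of the vertices outside A that are high (more than k/2
  -- neighbours in A), low (at most k/4) and middle.
  data Class (D : ℕ) : (χ η l m : ℕ) → Set where
    inside : Class D 1 0 0 0
    high   : Class D 0 1 0 0
    low    : 4 * D ≤ k → Class D 0 0 1 0
    middle : 2 * D ≤ k → k ≤ 4 * D → Class D 0 0 0 1

  abstract
    η l m : Vector ℕ n
    η b = indicator (k <? 2 * d b)
    l b = indicator (¬? (b ∈? A) ×-dec ¬? (k <? 2 * d b) ×-dec 4 * d b ≤? k)
    m b = indicator (¬? (b ∈? A) ×-dec ¬? (k <? 2 * d b) ×-dec ¬? (4 * d b ≤? k))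

    classify : ∀ b → Class (d b) (χ b) (η b) (l b) (m b)
    classify b = by (b ∈? A) (k <? 2 * d b) (4 * d b ≤? k)
      where
      by : (inA : Dec (b ∈ A)) (hi : Dec (k < 2 * d b)) (lo : Dec (4 * d b ≤ k)) →
           Class (d b) (indicator inA) (indicator hi)
             (indicator (¬? inA ×-dec ¬? hi ×-dec lo)) (indicator (¬? inA ×-dec ¬? hi ×-dec ¬? lo))
      -- `d` vanishes on `A`, so the threshold would read `k < 0`: high vertices lie outside `A`.
      by (yes b∈) (yes k<2d) _         = contradiction (subst (λ D → k < 2 * D) (d-inside b∈) k<2d) λ ()
      by (yes b∈) (no _)     _         = inside
      by (no _)   (yes _)    _         = high
      by (no _)   (no _)     (yes 4d≤) = low 4d≤
      by (no _)   (no k≮2d)  (no 4d≰)  = middle (ℕ.≮⇒≥ k≮2d) (ℕ.<⇒≤ (ℕ.≰⇒> 4d≰))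

    -- Two adjacent high vertices would have more than `k` neighbours in `A` together, against
    -- `d-disjoint`. So the high vertices form an independent set `H`, and maximality of `A` bounds
    -- its size.
    Ση≤k : sum η ≤ k
    Ση≤k = subst (_≤ k) (trans (∣∣≡sum H) (sum-cong-≗ H-indicator)) (A-maximum H H-independent)
      where
      H : Subset n
      H = Vec.tabulate λ b → does (k <? 2 * d b)
      H-lookup : ∀ b → Vec.lookup H b ≡ does (k <? 2 * d b)
      H-lookup = Vec.lookup∘tabulate (λ b → does (k <? 2 * d b))
      H-spec : ∀ {b} → b ∈ H → k < 2 * d b
      H-spec {b} b∈H = does-true (k <? 2 * d b) (trans (sym (H-lookup b)) (Vec.[]=⇒lookup b∈H))
      H-indicator : ∀ b → indicator (b ∈? H) ≡ η b
      H-indicator b = indicator-cong H-spec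
        (λ k<2d → Vec.lookup⇒[]= b H (trans (H-lookup b) (dec-true (k <? 2 * d b) k<2d)))
        (b ∈? H) (k <? 2 * d b)
      H-independent : Independent G H
      H-independent u v u∈ v∈ uv = ℕ.<⇒≱ (ℕ.+-mono-< (H-spec u∈) (H-spec v∈)) (begin
        2 * d u + 2 * d v   ≡⟨ ℕ.*-distribˡ-+ 2 (d u) (d v) ⟨
        2 * (d u + d v)     ≤⟨ ℕ.*-monoʳ-≤ 2 (d-disjoint uv) ⟩
        2 * k               ≡⟨ cong (k ℕ.+_) (ℕ.+-identityʳ k) ⟩
        k + k               ∎)

  lm : Vector ℕ n
  lm v = l v + m v

  -- The four classes partition the vertices; `A` has `k` elements and the high class at most `k`.
  Σlm : n ≤ 2 * k + sum lm
  Σlm = begin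
    n                                            ≡⟨ sum-ones n ⟨
    sum {n} (λ _ → 1)                            ≡⟨ sum-cong-≗ (λ b → one (classify b)) ⟩
    sum (λ v → χ v + (η v + lm v))               ≡⟨ ∑-distrib-+ χ (λ v → η v + lm v) ⟩
    sum χ + sum (λ v → η v + lm v)               ≡⟨ cong₂ _+_ (sym (∣∣≡sum A)) (∑-distrib-+ η lm) ⟩
    k + (sum η + sum lm)                         ≤⟨ ℕ.+-monoʳ-≤ k (ℕ.+-monoˡ-≤ (sum lm) Ση≤k) ⟩
    k + (k + sum lm)                             ≡⟨ ℕ.+-assoc k k (sum lm) ⟨
    k + k + sum lm                               ≡⟨ cong (λ z → k + z + sum lm) (ℕ.+-identityʳ k) ⟨
    2 * k + sum lm                               ∎
    where
    one : ∀ {D x e p q} → Class D x e p q → 1 ≡ x + (e + (p + q))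
    one inside       = refl
    one high         = refl
    one (low _)      = refl
    one (middle _ _) = refl

  -- For `f = 2 μ` the form is 8 times the edge sum of `μ`: a factor 4 from the values and 2 from
  -- counting ordered pairs. The target `n² / 50` for the edge sum thus becomes `4 n² / 25`.
  SparseDoubledHalf : Set
  SparseDoubledHalf = ∃ λ (f : Vector ℕ n) → (∀ v → f v ≤ 2) × sum f ≡ n × 25 * form f f ≤ 4 * (n * n)

  large-A : n ≤ 2 * k → SparseDoubledHalf
  large-A n≤2k with fill n (λ v → 2 * χ v) (ℕ.≤-trans n≤2k (ℕ.≤-reflexive
                      (trans (cong (2 *_) (∣∣≡sum A)) (*-distribˡ-sum 2 χ))))
  ... | f , f≤2χ , Σf = f
      , (λ v → ℕ.≤-trans (f≤2χ v) (ℕ.*-monoʳ-≤ 2 (indicator≤1 (v ∈? A))))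
      , Σf
      , subst (λ z → 25 * z ≤ 4 * (n * n)) (sym (independent⇒form≡0 (independent-≤ 2 χ f≤2χ independent-χ))) z≤n

  module _ {g} (n≡ : n ≡ 2 * k + g) (2g≤k : 2 * g ≤ k) where

    -- Since `A` spans no edge, the left side of the last inequality is exactly `form f f` for
    -- `f = 2 χ + ν`. The right side is a budget of `2 k` per unit of `ν`.
    Extension : Set
    Extension = ∃ λ (ν : Vector ℕ n) → (∀ v → ν v ≤ 2 * lm v) × sum ν ≡ g ×
                4 * sum (λ v → ν v * d v) + form ν ν ≤ 2 * k * g

    -- The difference of the sides is `2 (8k - g)(k - 2g)`; substituting `k = 2g + t` gives it
    -- nonnegative coefficients.
    arithmetic : 25 * (2 * k * g) ≤ 4 * ((2 * k + g) * (2 * k + g))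
    arithmetic with ℕ.m≤n⇒∃[o]m+o≡n 2g≤k
    ... | t , eq = subst (λ K → 25 * (2 * K * g) ≤ 4 * ((2 * K + g) * (2 * K + g))) eq (begin
      25 * (2 * (2 * g + t) * g)                                       ≤⟨ ℕ.m≤m+n _ _ ⟩
      25 * (2 * (2 * g + t) * g) + (30 * (g * t) + 16 * (t * t))       ≡⟨ identity g t ⟩
      4 * ((2 * (2 * g + t) + g) * (2 * (2 * g + t) + g))              ∎)
      where
      identity : ∀ g t → 25 * (2 * (2 * g + t) * g) + (30 * (g * t) + 16 * (t * t))
                       ≡ 4 * ((2 * (2 * g + t) + g) * (2 * (2 * g + t) + g))
      identity = solve-∀

    extend : Extension → SparseDoubledHalf
    extend (ν , ν≤ , Σν , cost) = f , (λ v → f≤2 (ν≤ v) (classify v)) , Σf , (begin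
      25 * form f f                                    ≡⟨ cong (25 *_) form-f ⟩
      25 * (4 * sum (λ v → ν v * d v) + form ν ν)      ≤⟨ ℕ.*-monoʳ-≤ 25 cost ⟩
      25 * (2 * k * g)                                 ≤⟨ arithmetic ⟩
      4 * ((2 * k + g) * (2 * k + g))                  ≡⟨ cong (λ N → 4 * (N * N)) n≡ ⟨
      4 * (n * n)                                      ∎)
      where
      f : Vector ℕ n
      f v = 2 * χ v + ν v

      f≤2 : ∀ {D x e p q y} → y ≤ 2 * (p + q) → Class D x e p q → 2 * x + y ≤ 2
      f≤2 y≤ inside       = ℕ.+-monoʳ-≤ 2 y≤
      f≤2 y≤ high         = ℕ.≤-trans y≤ z≤n
      f≤2 y≤ (low _)      = y≤
      f≤2 y≤ (middle _ _) = y≤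

      Σf : sum f ≡ n
      Σf = begin-equality
        sum f                        ≡⟨ ∑-distrib-+ (λ v → 2 * χ v) ν ⟩
        sum (λ v → 2 * χ v) + sum ν  ≡⟨ cong₂ _+_ (sym (*-distribˡ-sum 2 χ)) Σν ⟩
        2 * sum χ + g                ≡⟨ cong (λ z → 2 * z + g) (∣∣≡sum A) ⟨
        2 * k + g                    ≡⟨ n≡ ⟨
        n                            ∎

      form-f : form f f ≡ 4 * sum (λ v → ν v * d v) + form ν ν
      form-f = begin-equality
        form f f
          ≡⟨ form-square a-sym (λ v → 2 * χ v) ν ⟩
        form (λ v → 2 * χ v) (λ v → 2 * χ v) + form ν ν + (form ν (λ v → 2 * χ v) + form ν (λ v → 2 * χ v))
          ≡⟨ cong₂ (λ x y → x + form ν ν + (y + y))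
               (independent⇒form≡0 (independent-≤ 2 χ (λ _ → ℕ.≤-refl) independent-χ)) νχ ⟩
        form ν ν + (2 * form ν χ + 2 * form ν χ)
          ≡⟨ identity (form ν χ) (form ν ν) ⟩
        4 * form ν χ + form ν ν ∎
        where
        νχ : form ν (λ v → 2 * χ v) ≡ 2 * form ν χ
        νχ = begin-equality
          form ν (λ v → 2 * χ v)   ≡⟨ form-comm a-sym ν (λ v → 2 * χ v) ⟩
          form (λ v → 2 * χ v) ν   ≡⟨ form-*ˡ 2 χ ν ⟩
          2 * form χ ν             ≡⟨ cong (2 *_) (form-comm a-sym χ ν) ⟩
          2 * form ν χ             ∎
        identity : ∀ x y → y + (2 * x + 2 * x) ≡ 4 * x + y
        identity = solve-∀

    -- Inside one neighbourhood `ν` has no internal edges, and low and middle vertices have at most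
    -- `k / 2` neighbours in `A`, so each unit costs at most `4 d ≤ 2 k`. The factor 2 before
    -- `row lm b` is there because values go up to 2.
    dense-neighbourhood : ∀ b → g ≤ 2 * row lm b → Extension
    dense-neighbourhood b g≤ with fill g (λ v → 2 * (a b v * lm v))
                                  (ℕ.≤-trans g≤ (ℕ.≤-reflexive (*-distribˡ-sum 2 (λ v → a b v * lm v))))
    ... | ν , ν≤ , Σν = ν , ν≤2lm , Σν , (begin
      4 * sum (λ v → ν v * d v) + form ν ν   ≡⟨ cong (4 * sum (λ v → ν v * d v) ℕ.+_)
                                                  (independent⇒form≡0 (independent-≤ 2 (λ v → a b v * lm v) ν≤ (independent-neighbourhood b lm))) ⟩
      4 * sum (λ v → ν v * d v) + 0          ≡⟨ ℕ.+-identityʳ _ ⟩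
      4 * sum (λ v → ν v * d v)              ≡⟨ *-distribˡ-sum 4 (λ v → ν v * d v) ⟩
      sum (λ v → 4 * (ν v * d v))            ≤⟨ sum-mono (λ v → step (ν≤2lm v) (classify v)) ⟩
      sum (λ v → 2 * k * ν v)                ≡⟨ *-distribˡ-sum (2 * k) ν ⟨
      2 * k * sum ν                          ≡⟨ cong (2 * k *_) Σν ⟩
      2 * k * g                              ∎)
      where
      ν≤2lm : ∀ v → ν v ≤ 2 * lm v
      ν≤2lm v = ℕ.≤-trans (ν≤ v) (ℕ.*-monoʳ-≤ 2 (ℕ.≤-trans
        (ℕ.*-monoˡ-≤ (lm v) (indicator≤1 (adj? G b v))) (ℕ.≤-reflexive (ℕ.*-identityˡ (lm v)))))
      step : ∀ {D x e p q y} → y ≤ 2 * (p + q) → Class D x e p q → 4 * (y * D) ≤ 2 * k * y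
      step {D} {y = y} y≤ cl = begin
        4 * (y * D)     ≡⟨ identity y D ⟩
        2 * (y * (2 * D)) ≤⟨ ℕ.*-monoʳ-≤ 2 (aux cl y≤) ⟩
        2 * (y * k)     ≡⟨ identity′ y k ⟩
        2 * k * y       ∎
        where
        identity : ∀ y D → 4 * (y * D) ≡ 2 * (y * (2 * D))
        identity = solve-∀
        identity′ : ∀ y k → 2 * (y * k) ≡ 2 * k * y
        identity′ = solve-∀
        aux : ∀ {D x e p q} → Class D x e p q → y ≤ 2 * (p + q) → y * (2 * D) ≤ y * k
        aux inside y≤0 rewrite ℕ.n≤0⇒n≡0 y≤0 = z≤n
        aux high   y≤0 rewrite ℕ.n≤0⇒n≡0 y≤0 = z≤n
        aux {D} (low 4D≤) _  = ℕ.*-monoʳ-≤ y (ℕ.≤-trans (ℕ.*-monoˡ-≤ D {2} {4} (s≤s (s≤s z≤n))) 4D≤)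
        aux (middle 2D≤ _) _ = ℕ.*-monoʳ-≤ y 2D≤

    g≤Σlm : g ≤ sum lm
    g≤Σlm = ℕ.+-cancelˡ-≤ (2 * k) g (sum lm) (subst (_≤ 2 * k + sum lm) n≡ Σlm)

    4D≤2k : ∀ {D} → 2 * D ≤ k → 4 * D ≤ 2 * k
    4D≤2k {D} 2D≤k = subst (_≤ 2 * k) (sym (ℕ.*-assoc 2 2 D)) (ℕ.*-monoʳ-≤ 2 2D≤k)

    -- The cost inequality for loading 2 on S = low ∪ (middle ∩ N(p)) and g − 2|S| elsewhere, with
    -- terms moved so that no subtraction occurs.
    Heavy : Fin n → Set
    Heavy p = sum (λ b → 8 * (a p b * m b * d b)) + (sum (λ b → 8 * (l b * d b)) + k * g)
            ≤ 6 * k * sum (λ b → a p b * m b) + 4 * k * sum l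

    -- The inequality holds on average over `p` in `A`. After the summation it splits into one
    -- polynomial inequality per vertex, proved in `pointwise`.
    heavy-vertex : 0 < k → ∃ Heavy
    heavy-vertex 0<k with weighted-pigeonhole χ L R (subst (0 <_) (∣∣≡sum A) 0<k) average
      where
      w w′ L R : Vector ℕ n
      w b  = 8 * (m b * d b)
      w′ b = 6 * k * m b
      C = sum (λ b → 8 * (l b * d b)) + k * g
      L p = row w p + C
      R p = row w′ p + 4 * k * sum l

      -- Double counting: a vertex `b` is adjacent to exactly `d b` of the vertices `p` in `A`.
      total : ∀ x c → sum (λ p → χ p * (row x p + c)) ≡ sum (λ b → x b * d b) + k * c
      total x c = begin-equality
        sum (λ p → χ p * (row x p + c))
          ≡⟨ sum-cong-≗ (λ p → ℕ.*-distribˡ-+ (χ p) (row x p) c) ⟩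
        sum (λ p → χ p * row x p + χ p * c)
          ≡⟨ ∑-distrib-+ (λ p → χ p * row x p) (λ p → χ p * c) ⟩
        form χ x + sum (λ p → χ p * c)
          ≡⟨ cong₂ _+_ (form-comm a-sym χ x) (sym (*-distribʳ-sum c χ)) ⟩
        form x χ + sum χ * c
          ≡⟨ cong (λ z → form x χ + z * c) (∣∣≡sum A) ⟨
        sum (λ b → x b * d b) + k * c ∎

      -- A low vertex needs `8 k D ≤ 3 k²`, which follows from `4 D ≤ k`. For a middle vertex the
      -- slack is `(4 D - k)(k - 2 D)`; with `k = 2 D + t` this comes down to `t ≤ 2 D`.
      pointwise : ∀ {D x e p q} → Class D x e p q →
        8 * (q * D) * D + (k * (8 * (p * D)) + k * k * (p + q)) ≤ 6 * k * q * D + 4 * k * k * p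
      pointwise {D} inside rewrite ℕ.*-zeroʳ (k * k) | ℕ.*-zeroʳ k = z≤n
      pointwise {D} high   rewrite ℕ.*-zeroʳ (k * k) | ℕ.*-zeroʳ k = z≤n
      pointwise {D} (low 4D≤k) with ℕ.m≤n⇒∃[o]m+o≡n 4D≤k
      ... | t , eq = subst (λ k → k * (8 * (1 * D)) + k * k * 1 ≤ 6 * k * 0 * D + 4 * k * k * 1) eq
        (ℕ.≤-trans (ℕ.m≤m+n _ (16 * D * D + 16 * D * t + 3 * t * t)) (ℕ.≤-reflexive (identity D t)))
        where
        identity : ∀ D t → (4 * D + t) * (8 * (1 * D)) + (4 * D + t) * (4 * D + t) * 1
                           + (16 * D * D + 16 * D * t + 3 * t * t)
                         ≡ 6 * (4 * D + t) * 0 * D + 4 * (4 * D + t) * (4 * D + t) * 1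
        identity = solve-∀
      pointwise {D} (middle 2D≤k k≤4D) with ℕ.m≤n⇒∃[o]m+o≡n 2D≤k
      ... | t , eq = subst (λ k → 8 * (1 * D) * D + (k * (8 * (0 * D)) + k * k * (0 + 1))
                                  ≤ 6 * k * 1 * D + 4 * k * k * 0) eq (begin
        8 * (1 * D) * D + ((2 * D + t) * (8 * (0 * D)) + (2 * D + t) * (2 * D + t) * (0 + 1))
          ≡⟨ identity D t ⟩
        12 * D * D + 4 * D * t + t * t
          ≤⟨ ℕ.+-monoʳ-≤ (12 * D * D + 4 * D * t) (ℕ.*-monoʳ-≤ t t≤2D) ⟩
        12 * D * D + 4 * D * t + t * (2 * D)
          ≡⟨ identity′ D t ⟩
        6 * (2 * D + t) * 1 * D + 4 * (2 * D + t) * (2 * D + t) * 0 ∎)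
        where
        identity : ∀ D t → 8 * (1 * D) * D + ((2 * D + t) * (8 * (0 * D)) + (2 * D + t) * (2 * D + t) * (0 + 1))
                         ≡ 12 * D * D + 4 * D * t + t * t
        identity = solve-∀
        identity′ : ∀ D t → 12 * D * D + 4 * D * t + t * (2 * D)
                          ≡ 6 * (2 * D + t) * 1 * D + 4 * (2 * D + t) * (2 * D + t) * 0
        identity′ = solve-∀
        t≤2D : t ≤ 2 * D
        t≤2D = ℕ.+-cancelˡ-≤ (2 * D) t (2 * D)
          (subst₂ _≤_ (sym eq) (ℕ.*-distribʳ-+ D 2 2) k≤4D)

      average : sum (λ p → χ p * L p) ≤ sum (λ p → χ p * R p)
      average = begin
        sum (λ p → χ p * L p)
          ≡⟨ total w C ⟩
        sum (λ b → w b * d b) + k * (sum (λ b → 8 * (l b * d b)) + k * g)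
          -- Bounding `g` by the number of low and middle vertices turns the constant `k * g` into a
          -- sum over vertices, ready to be compared term by term.
          ≤⟨ ℕ.+-monoʳ-≤ _ (ℕ.*-monoʳ-≤ k (ℕ.+-monoʳ-≤ _ (ℕ.*-monoʳ-≤ k g≤Σlm))) ⟩
        sum (λ b → w b * d b) + k * (sum (λ b → 8 * (l b * d b)) + k * sum lm)
          ≡⟨ cong (sum (λ b → w b * d b) ℕ.+_) (trans (ℕ.*-distribˡ-+ k (sum (λ b → 8 * (l b * d b))) (k * sum lm))
               (cong₂ _+_ (*-distribˡ-sum k (λ b → 8 * (l b * d b)))
                          (trans (sym (ℕ.*-assoc k k (sum lm))) (*-distribˡ-sum (k * k) lm)))) ⟩
        sum (λ b → w b * d b) + (sum (λ b → k * (8 * (l b * d b))) + sum (λ b → k * k * lm b))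
          ≡⟨ cong (sum (λ b → w b * d b) ℕ.+_) (∑-distrib-+ (λ b → k * (8 * (l b * d b))) (λ b → k * k * lm b)) ⟨
        sum (λ b → w b * d b) + sum (λ b → k * (8 * (l b * d b)) + k * k * lm b)
          ≡⟨ ∑-distrib-+ (λ b → w b * d b) (λ b → k * (8 * (l b * d b)) + k * k * lm b) ⟨
        sum (λ b → w b * d b + (k * (8 * (l b * d b)) + k * k * lm b))
          ≤⟨ sum-mono (λ b → pointwise (classify b)) ⟩
        sum (λ b → w′ b * d b + 4 * k * k * l b)
          ≡⟨ ∑-distrib-+ (λ b → w′ b * d b) (λ b → 4 * k * k * l b) ⟩
        sum (λ b → w′ b * d b) + sum (λ b → 4 * k * k * l b)
          ≡⟨ cong (sum (λ b → w′ b * d b) ℕ.+_) (trans (sym (*-distribˡ-sum (4 * k * k) l)) (shuffle k (sum l))) ⟩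
        sum (λ b → w′ b * d b) + k * (4 * k * sum l)
          ≡⟨ total w′ (4 * k * sum l) ⟨
        sum (λ p → χ p * R p) ∎
        where
        shuffle : ∀ k s → 4 * k * k * s ≡ k * (4 * k * s)
        shuffle = solve-∀
    ... | p , _ , Lp≤Rp = p , subst₂ _≤_
      (cong (_+ (sum (λ b → 8 * (l b * d b)) + k * g)) (sum-cong-≗ λ b → shuffle (a p b) (m b) (d b)))
      (cong (_+ 4 * k * sum l) (row-* (6 * k) m p)) Lp≤Rp
      where
      shuffle : ∀ x y z → x * (8 * (y * z)) ≡ 8 * (x * y * z)
      shuffle = solve-∀

    module _ (sparse : ∀ b → 2 * row lm b ≤ g) (p : Fin n) (heavy : Heavy p) where

      -- All three are 0-1 vectors, so the truncated subtraction in `Y` is an honest complement. `X`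
      -- marks the middle neighbours of `p`, and `S` the vertices loaded first.
      X Y S : Vector ℕ n
      X b = a p b * m b
      Y b = 1 ∸ X b
      S b = X b + l b

      X≤m : ∀ b → X b ≤ m b
      X≤m b = ℕ.≤-trans (ℕ.*-monoˡ-≤ (m b) (indicator≤1 (adj? G p b))) (ℕ.≤-reflexive (ℕ.*-identityˡ (m b)))

      S≤lm : ∀ b → S b ≤ lm b
      S≤lm b = ℕ.≤-trans (ℕ.+-monoˡ-≤ (l b) (X≤m b)) (ℕ.≤-reflexive (ℕ.+-comm (m b) (l b)))

      -- Neighbours of `p` are pairwise non-adjacent, so every edge has an endpoint with `Y = 1` and
      -- can be charged to it. Sparsity gives `row ν u ≤ g`; the two possible endpoints give `2 g`,
      -- which is at most `k`.
      form-bound : ∀ {ν} → (∀ v → ν v ≤ 2 * lm v) → form ν ν ≤ k * sum (λ b → Y b * ν b)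
      form-bound {ν} ν≤ = begin
        form ν ν                                             ≤⟨ sum-mono cover ⟩
        sum (λ u → Yν u * row ν u + ν u * row Yν u)          ≡⟨ ∑-distrib-+ (λ u → Yν u * row ν u) (λ u → ν u * row Yν u) ⟩
        form Yν ν + form ν Yν                                ≡⟨ cong (form Yν ν ℕ.+_) (form-comm a-sym ν Yν) ⟩
        form Yν ν + form Yν ν                                ≤⟨ ℕ.+-mono-≤ half half ⟩
        g * sum Yν + g * sum Yν                              ≡⟨ double g (sum Yν) ⟩
        2 * g * sum Yν                                       ≤⟨ ℕ.*-monoˡ-≤ (sum Yν) 2g≤k ⟩
        k * sum Yν                                           ∎
        where
        Yν : Vector ℕ n
        Yν b = Y b * ν b

        double : ∀ x y → x * y + x * y ≡ 2 * x * y
        double = solve-∀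

        row≤g : ∀ u → row ν u ≤ g
        row≤g u = begin
          row ν u                    ≤⟨ sum-mono (λ v → ℕ.*-monoʳ-≤ (a u v) (ν≤ v)) ⟩
          row (λ v → 2 * lm v) u     ≡⟨ row-* 2 lm u ⟩
          2 * row lm u               ≤⟨ sparse u ⟩
          g                          ∎

        half : form Yν ν ≤ g * sum Yν
        half = begin
          form Yν ν                  ≤⟨ sum-mono (λ u → ℕ.*-monoʳ-≤ (Yν u) (row≤g u)) ⟩
          sum (λ u → Yν u * g)       ≡⟨ *-distribʳ-sum g Yν ⟨
          sum Yν * g                 ≡⟨ ℕ.*-comm (sum Yν) g ⟩
          g * sum Yν                 ∎

        edge : ∀ u v → ν u * (a u v * ν v) ≤ Yν u * (a u v * ν v) + ν u * (a u v * Yν v)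
        edge u v = by (adj? G u v)
          where
          by : (uv? : Dec (Adj G u v)) → ν u * (indicator uv? * ν v)
             ≤ Yν u * (indicator uv? * ν v) + ν u * (indicator uv? * Yν v)
          by (no _) = ℕ.≤-trans (ℕ.≤-reflexive (ℕ.*-zeroʳ (ν u))) z≤n
          by (yes uv) with independent-neighbourhood p m uv
          ... | inj₁ Xu≡0 rewrite Xu≡0 | ℕ.*-identityˡ (ν u) = ℕ.m≤m+n _ _
          ... | inj₂ Xv≡0 rewrite Xv≡0 | ℕ.+-identityʳ (ν v) | ℕ.+-identityʳ (ν v) = ℕ.m≤n+m _ _

        cover : ∀ u → ν u * row ν u ≤ Yν u * row ν u + ν u * row Yν u
        cover u = begin
          ν u * row ν u
            ≡⟨ *-distribˡ-sum (ν u) (λ v → a u v * ν v) ⟩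
          sum (λ v → ν u * (a u v * ν v))
            ≤⟨ sum-mono (edge u) ⟩
          sum (λ v → Yν u * (a u v * ν v) + ν u * (a u v * Yν v))
            ≡⟨ ∑-distrib-+ (λ v → Yν u * (a u v * ν v)) (λ v → ν u * (a u v * Yν v)) ⟩
          sum (λ v → Yν u * (a u v * ν v)) + sum (λ v → ν u * (a u v * Yν v))
            ≡⟨ cong₂ _+_ (*-distribˡ-sum (Yν u) (λ v → a u v * ν v)) (*-distribˡ-sum (ν u) (λ v → a u v * Yν v)) ⟨
          Yν u * row ν u + ν u * row Yν u ∎

      -- Edges to `A` and internal edges merge into a price of `4 d + k Y` per unit. This is at most
      -- `2 k` on `S` and at most `3 k` on the remaining middle vertices.
      cost-bound : ∀ {ν} → (∀ v → ν v ≤ 2 * lm v) →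
        sum (λ b → ν b * (4 * d b + k * Y b)) ≤ 2 * k * g →
        4 * sum (λ v → ν v * d v) + form ν ν ≤ 2 * k * g
      cost-bound {ν} ν≤ le = begin
        4 * sum (λ v → ν v * d v) + form ν ν
          ≤⟨ ℕ.+-monoʳ-≤ _ (form-bound ν≤) ⟩
        4 * sum (λ v → ν v * d v) + k * sum (λ b → Y b * ν b)
          ≡⟨ cong₂ _+_ (*-distribˡ-sum 4 (λ v → ν v * d v)) (*-distribˡ-sum k (λ b → Y b * ν b)) ⟩
        sum (λ v → 4 * (ν v * d v)) + sum (λ b → k * (Y b * ν b))
          ≡⟨ ∑-distrib-+ (λ v → 4 * (ν v * d v)) (λ b → k * (Y b * ν b)) ⟨
        sum (λ v → 4 * (ν v * d v) + k * (Y v * ν v))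
          ≡⟨ sum-cong-≗ (λ v → shuffle (ν v) (d v) k (Y v)) ⟩
        sum (λ b → ν b * (4 * d b + k * Y b))
          ≤⟨ le ⟩
        2 * k * g ∎
        where
        shuffle : ∀ x D k y → 4 * (x * D) + k * (y * x) ≡ x * (4 * D + k * y)
        shuffle = solve-∀

      -- Everything fits on `S`, where the price meets the budget: low vertices pay at most `k + k`,
      -- and middle neighbours of `p` pay `4 d ≤ 2 k` because `Y` vanishes there.
      inside-S : g ≤ 2 * sum S → Extension
      inside-S g≤ with fill g (λ v → 2 * S v) (ℕ.≤-trans g≤ (ℕ.≤-reflexive (*-distribˡ-sum 2 S)))
      ... | ν , ν≤ , Σν = ν , ν≤2lm , Σν , cost-bound ν≤2lm (begin
        sum (λ b → ν b * (4 * d b + k * Y b))   ≤⟨ sum-mono (λ b → pointwise (classify b) (X≤m b) (ν≤ b)) ⟩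
        sum (λ b → 2 * k * ν b)                 ≡⟨ *-distribˡ-sum (2 * k) ν ⟨
        2 * k * sum ν                           ≡⟨ cong (2 * k *_) Σν ⟩
        2 * k * g                               ∎)
        where
        ν≤2lm : ∀ v → ν v ≤ 2 * lm v
        ν≤2lm v = ℕ.≤-trans (ν≤ v) (ℕ.*-monoʳ-≤ 2 (S≤lm v))
        bounded : ∀ {c} y → c ≤ 2 * k → y * c ≤ 2 * k * y
        bounded y c≤ = ℕ.≤-trans (ℕ.*-monoʳ-≤ y c≤) (ℕ.≤-reflexive (ℕ.*-comm y (2 * k)))
        pointwise : ∀ {D c e p q x y} → Class D c e p q → x ≤ q → y ≤ 2 * (x + p) →
                    y * (4 * D + k * (1 ∸ x)) ≤ 2 * k * y
        pointwise inside z≤n z≤n = z≤n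
        pointwise high   z≤n z≤n = z≤n
        pointwise {D} {y = y} (low 4D≤) z≤n _ = bounded y
          (ℕ.+-mono-≤ 4D≤ (ℕ.≤-reflexive (trans (ℕ.*-identityʳ k) (sym (ℕ.+-identityʳ k)))))
        pointwise (middle _ _) z≤n z≤n = z≤n
        pointwise {D} {y = y} (middle 2D≤ _) (s≤s z≤n) _ = bounded y
          (ℕ.≤-trans (ℕ.≤-reflexive (trans (cong (4 * D ℕ.+_) (ℕ.*-zeroʳ k)) (ℕ.+-identityʳ (4 * D)))) (4D≤2k {D} 2D≤))

      -- `S` is saturated with the value 2 and the remainder `ρ` goes to the middle vertices not
      -- adjacent to `p`. Their excess price is compensated by what `S` saves, and `heavy` says that
      -- the saving suffices.
      beyond-S : 2 * sum S ≤ g → Extension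
      beyond-S 2S≤g with fill (g ∸ 2 * sum S) (λ v → 2 * (m v ∸ X v)) room
        where
        room : g ∸ 2 * sum S ≤ sum (λ v → 2 * (m v ∸ X v))
        room = ℕ.m≤n+o⇒m∸n≤o g (2 * sum S) (begin
          g                                                  ≤⟨ g≤Σlm ⟩
          sum lm                                             ≤⟨ ℕ.m≤n*m (sum lm) 2 ⟩
          2 * sum lm                                         ≡⟨ *-distribˡ-sum 2 lm ⟩
          sum (λ v → 2 * lm v)                               ≡⟨ sum-cong-≗ split ⟩
          sum (λ v → 2 * S v + 2 * (m v ∸ X v))              ≡⟨ ∑-distrib-+ (λ v → 2 * S v) (λ v → 2 * (m v ∸ X v)) ⟩
          sum (λ v → 2 * S v) + sum (λ v → 2 * (m v ∸ X v))  ≡⟨ cong (_+ sum (λ v → 2 * (m v ∸ X v))) (*-distribˡ-sum 2 S) ⟨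
          2 * sum S + sum (λ v → 2 * (m v ∸ X v))            ∎)
          where
          split : ∀ v → 2 * lm v ≡ 2 * S v + 2 * (m v ∸ X v)
          split v = begin-equality
            2 * lm v                         ≡⟨ cong (λ z → 2 * (l v + z)) (ℕ.m+[n∸m]≡n (X≤m v)) ⟨
            2 * (l v + (X v + (m v ∸ X v)))  ≡⟨ shuffle (l v) (X v) (m v ∸ X v) ⟩
            2 * S v + 2 * (m v ∸ X v)        ∎
            where
            shuffle : ∀ x y z → 2 * (x + (y + z)) ≡ 2 * (y + x) + 2 * z
            shuffle = solve-∀
      -- Adding `k * g` to both sides completes the left side of `heavy`; the target then becomes
      -- `3 k g`, the price of `g` units at `3 k` each.
      ... | ρ , ρ≤ , Σρ = ν , ν≤2lm , Σν , cost-bound ν≤2lm (ℕ.+-cancelʳ-≤ (k * g) _ _ (begin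
        sum (λ b → ν b * (4 * d b + k * Y b)) + k * g
          ≤⟨ ℕ.+-monoˡ-≤ (k * g) (sum-mono (λ b → pointwise (classify b) (X≤m b) (ρ≤ b))) ⟩
        sum (λ b → T b + (U b + (2 * k * l b + 3 * k * ρ b))) + k * g
          ≡⟨ cong (_+ k * g) sums ⟩
        sum T + (sum U + (2 * k * sum l + 3 * k * sum ρ)) + k * g
          ≡⟨ shuffle (sum T) (sum U) (2 * k * sum l + 3 * k * sum ρ) (k * g) ⟩
        sum T + (sum U + k * g) + (2 * k * sum l + 3 * k * sum ρ)
          ≤⟨ ℕ.+-monoˡ-≤ _ heavy ⟩
        6 * k * sum X + 4 * k * sum l + (2 * k * sum l + 3 * k * sum ρ)
          ≡⟨ collect k (sum X) (sum l) (sum ρ) ⟩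
        3 * k * (2 * (sum X + sum l) + sum ρ)
          ≡⟨ cong (λ z → 3 * k * (2 * z + sum ρ)) (∑-distrib-+ X l) ⟨
        3 * k * (2 * sum S + sum ρ)
          ≡⟨ cong (3 * k *_) 2S+ρ ⟩
        3 * k * g
          ≡⟨ three k g ⟩
        2 * k * g + k * g ∎))
        where
        ν T U : Vector ℕ n
        ν v = 2 * S v + ρ v
        T b = 8 * (X b * d b)
        U b = 8 * (l b * d b)

        shuffle : ∀ x y z w → x + (y + z) + w ≡ x + (y + w) + z
        shuffle = solve-∀
        collect : ∀ k x y z → 6 * k * x + 4 * k * y + (2 * k * y + 3 * k * z) ≡ 3 * k * (2 * (x + y) + z)
        collect = solve-∀
        three : ∀ k g → 3 * k * g ≡ 2 * k * g + k * g
        three = solve-∀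

        sums : sum (λ b → T b + (U b + (2 * k * l b + 3 * k * ρ b)))
             ≡ sum T + (sum U + (2 * k * sum l + 3 * k * sum ρ))
        sums = trans (∑-distrib-+ T (λ b → U b + (2 * k * l b + 3 * k * ρ b))) (cong (sum T ℕ.+_)
          (trans (∑-distrib-+ U (λ b → 2 * k * l b + 3 * k * ρ b)) (cong (sum U ℕ.+_)
          (trans (∑-distrib-+ (λ b → 2 * k * l b) (λ b → 3 * k * ρ b))
            (cong₂ _+_ (sym (*-distribˡ-sum (2 * k) l)) (sym (*-distribˡ-sum (3 * k) ρ)))))))

        2S+ρ : 2 * sum S + sum ρ ≡ g
        2S+ρ = trans (cong (2 * sum S ℕ.+_) Σρ) (ℕ.m+[n∸m]≡n 2S≤g)

        Σν : sum ν ≡ g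
        Σν = trans (∑-distrib-+ (λ v → 2 * S v) ρ)
          (trans (cong (_+ sum ρ) (sym (*-distribˡ-sum 2 S))) 2S+ρ)

        ν≤2lm : ∀ v → ν v ≤ 2 * lm v
        ν≤2lm v = begin
          2 * S v + ρ v                      ≤⟨ ℕ.+-monoʳ-≤ (2 * S v) (ρ≤ v) ⟩
          2 * S v + 2 * (m v ∸ X v)          ≡⟨ ℕ.*-distribˡ-+ 2 (S v) (m v ∸ X v) ⟨
          2 * (S v + (m v ∸ X v))            ≡⟨ cong (2 *_) (trans (cong (_+ (m v ∸ X v)) (ℕ.+-comm (X v) (l v)))
                                                  (trans (ℕ.+-assoc (l v) (X v) (m v ∸ X v))
                                                    (cong (l v ℕ.+_) (ℕ.m+[n∸m]≡n (X≤m v))))) ⟩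
          2 * lm v                           ∎

        pointwise : ∀ {D c e p q x r} → Class D c e p q → x ≤ q → r ≤ 2 * (q ∸ x) →
          (2 * (x + p) + r) * (4 * D + k * (1 ∸ x)) ≤ 8 * (x * D) + (8 * (p * D) + (2 * k * p + 3 * k * r))
        pointwise inside z≤n z≤n = z≤n
        pointwise high   z≤n z≤n = z≤n
        pointwise {D} (low _) z≤n z≤n = ℕ.≤-reflexive (identity k D)
          where
          identity : ∀ k D → (2 * (0 + 1) + 0) * (4 * D + k * 1) ≡ 8 * (0 * D) + (8 * (1 * D) + (2 * k * 1 + 3 * k * 0))
          identity = solve-∀
        pointwise {D} {r = r} (middle 2D≤ _) z≤n _ = begin
          (2 * (0 + 0) + r) * (4 * D + k * 1)   ≤⟨ ℕ.*-monoʳ-≤ r (ℕ.+-monoˡ-≤ (k * 1) (4D≤2k {D} 2D≤)) ⟩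
          r * (2 * k + k * 1)                   ≡⟨ identity k D r ⟩
          8 * (0 * D) + (8 * (0 * D) + (2 * k * 0 + 3 * k * r)) ∎
          where
          identity : ∀ k D r → r * (2 * k + k * 1) ≡ 8 * (0 * D) + (8 * (0 * D) + (2 * k * 0 + 3 * k * r))
          identity = solve-∀
        pointwise {D} (middle _ _) (s≤s z≤n) z≤n = ℕ.≤-reflexive (identity k D)
          where
          identity : ∀ k D → (2 * (1 + 0) + 0) * (4 * D + k * 0) ≡ 8 * (1 * D) + (8 * (0 * D) + (2 * k * 0 + 3 * k * 0))
          identity = solve-∀

    extension-sparse : (∀ b → 2 * row lm b ≤ g) → ∃ Heavy → Extension
    extension-sparse sparse (p , heavy) =
      [ inside-S sparse p heavy , beyond-S sparse p heavy ]′ (ℕ.≤-total g (2 * sum (S sparse p heavy)))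

    extension : 0 < k → Extension
    extension 0<k = by (Fin.any? (λ b → g ≤? 2 * row lm b))
      where
      by : Dec (∃ λ b → g ≤ 2 * row lm b) → Extension
      by (yes (b , g≤)) = dense-neighbourhood b g≤
      by (no none)      = extension-sparse (λ b → ℕ.<⇒≤ (ℕ.≰⇒> λ g≤ → none (b , g≤))) (heavy-vertex 0<k)

  sparse-half : 0 < n → 2 * n ≤ 5 * k → SparseDoubledHalf
  sparse-half 0<n 2n≤5k with ℕ.≤-total n (2 * k)
  ... | inj₁ n≤2k = large-A n≤2k
  ... | inj₂ 2k≤n with ℕ.m≤n⇒∃[o]m+o≡n 2k≤n
  ...   | g , eq = extend (sym eq) 2g≤k (extension (sym eq) 2g≤k 0<k)
    where
    -- With `n = 2 k + g` the hypothesis `2 n ≤ 5 k` reads `4 k + 2 g ≤ 5 k`.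
    2g≤k : 2 * g ≤ k
    2g≤k = ℕ.+-cancelˡ-≤ (4 * k) (2 * g) k (begin
      4 * k + 2 * g       ≡⟨ cong (_+ 2 * g) (ℕ.*-assoc 2 2 k) ⟩
      2 * (2 * k) + 2 * g ≡⟨ ℕ.*-distribˡ-+ 2 (2 * k) g ⟨
      2 * (2 * k + g)     ≡⟨ cong (2 *_) eq ⟩
      2 * n               ≤⟨ 2n≤5k ⟩
      5 * k               ≡⟨ ℕ.*-distribʳ-+ k 4 1 ⟩
      4 * k + 1 * k       ≡⟨ cong (4 * k ℕ.+_) (ℕ.*-identityˡ k) ⟩
      4 * k + k           ∎)
    0<k : 0 < k
    0<k = ℕ.n≢0⇒n>0 λ k≡0 → ℕ.<⇒≱ (ℕ.*-monoʳ-< 2 0<n) (subst (λ k → 2 * n ≤ 5 * k) k≡0 2n≤5k)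

-- Kronecker deltas, and natural numbers inside the rationals.

module Kronecker {c ℓ} (R : CommutativeSemiring c ℓ) where

  private module R = CommutativeSemiring R
  open R using (Carrier; _+_; _*_; _≈_; 0#; 1#)
  open SemiringSum R.semiring

  δ : ∀ {n} → Fin n → Vector Carrier n
  δ i v = if does (i Fin.≟ v) then 1# else 0#

  δ-≡ : ∀ {n} (i : Fin n) → δ i i ≡ 1#
  δ-≡ i = cong (if_then 1# else 0#) (dec-true (i Fin.≟ i) refl)

  δ-≢ : ∀ {n} {i v : Fin n} → i ≢ v → δ i v ≡ 0#
  δ-≢ {i = i} {v} i≢v = cong (if_then 1# else 0#) (dec-false (i Fin.≟ v) i≢v)

  sum-δ : ∀ {n} (i : Fin n) (x : Vector Carrier n) → sum (λ v → δ i v * x v) ≈ x i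
  sum-δ {suc n} zero x = R.trans (R.+-cong (R.*-identityˡ (x zero))
    (R.trans (sum-cong-≋ λ v → R.zeroˡ (x (suc v))) (sum-replicate-zero n))) (R.+-identityʳ (x zero))
  sum-δ {suc n} (suc i) x = R.trans (R.+-cong (R.zeroˡ (x zero)) (sum-δ i (x ∘ suc))) (R.+-identityˡ (x (suc i)))

module ι where

  abstract
    -- Given directly in lowest terms, so that order and arithmetic reduce to the integers with no
    -- fraction to normalise.
    ι : ℕ → ℚ
    ι n = mkℚ (+ n) 0 (Coprime.sym (Coprime.1-coprimeTo n))

    ι-0 : ι 0 ≡ 0ℚ
    ι-0 = refl

    ι-1 : ι 1 ≡ 1ℚ
    ι-1 = refl

    ι-+ : ∀ m n → ι (m ℕ.+ n) ≡ ι m ℚ.+ ι n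
    ι-+ m n = ℚ.toℚᵘ-injective (ℚᵘ.≃-trans
      (*≡* (cong (ℤ._* + 1) (sym (cong₂ ℤ._+_ (ℤ.*-identityʳ (+ m)) (ℤ.*-identityʳ (+ n))))))
      (ℚᵘ.≃-sym (ℚ.toℚᵘ-homo-+ (ι m) (ι n))))

    ι-* : ∀ m n → ι (m ℕ.* n) ≡ ι m ℚ.* ι n
    ι-* m n = ℚ.toℚᵘ-injective (ℚᵘ.≃-trans
      (*≡* (cong (ℤ._* + 1) (ℤ.pos-* m n))) (ℚᵘ.≃-sym (ℚ.toℚᵘ-homo-* (ι m) (ι n))))

    ι-mono : ∀ {m n} → m ℕ.≤ n → ι m ℚ.≤ ι n
    ι-mono m≤n = *≤* (ℤ.*-monoʳ-≤-nonNeg (+ 1) (ℤ.+≤+ m≤n))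

    ι-cancel : ∀ {m n} → ι m ℚ.≤ ι n → m ℕ.≤ n
    ι-cancel (*≤* m≤n) = ℤ.drop‿+≤+ (ℤ.*-cancelʳ-≤-pos _ _ (+ 1) m≤n)

    /-*-ι : ∀ m d .{{_ : NonZero d}} → (+ m / d) ℚ.* ι d ≡ ι m
    /-*-ι m (suc d) = ℚ.toℚᵘ-injective (ℚᵘ.≃-trans (ℚ.toℚᵘ-homo-* (+ m / suc d) (ι (suc d)))
      (ℚᵘ.≃-trans (ℚᵘ.*-congʳ {toℚᵘ (ι (suc d))} (ℚ.toℚᵘ-fromℚᵘ (mkℚᵘ (+ m) d)))
        (*≡* (ℤ.*-assoc (+ m) (+ suc d) (+ 1)))))

open ι public

ι-/1 : ∀ n → ι n ≡ + n / 1
ι-/1 n = trans (sym (/-*-ι n 1)) (trans (cong ((+ n / 1) ℚ.*_) ι-1) (ℚ.*-identityʳ (+ n / 1)))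

½*2 : ½ ℚ.* ι 2 ≡ 1ℚ
½*2 = cong (½ ℚ.*_) (ι-/1 2)

0≤ι : ∀ n → 0ℚ ℚ.≤ ι n
0≤ι n = subst (ℚ._≤ ι n) ι-0 (ι-mono z≤n)

ℚ-semiring : CommutativeSemiring _ _
ℚ-semiring = CommutativeRing.commutativeSemiring ℚ.+-*-commutativeRing

module ℚOrder where
  open import Data.Rational using (_+_; _*_; _-_; -_; _≤_)

  0≤-+ : ∀ {p q} → 0ℚ ≤ p → 0ℚ ≤ q → 0ℚ ≤ p + q
  0≤-+ 0≤p 0≤q = ℚ.+-mono-≤ 0≤p 0≤q

  0≤-* : ∀ {p q} → 0ℚ ≤ p → 0ℚ ≤ q → 0ℚ ≤ p * q
  0≤-* {p} {q} 0≤p 0≤q = ℚ.nonNegative⁻¹ _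
    {{ℚ.nonNeg*nonNeg⇒nonNeg p {{ℚ.nonNegative 0≤p}} q {{ℚ.nonNegative 0≤q}}}}

  ≤⇒0≤- : ∀ {p q} → p ≤ q → 0ℚ ≤ q - p
  ≤⇒0≤- {p} {q} p≤q = subst (_≤ q - p) (ℚ.+-inverseʳ p) (ℚ.+-monoˡ-≤ (- p) p≤q)

  -- Proves an inequality by exhibiting its slack `r`, which leaves a ring identity.
  gap : ∀ {p q} r → 0ℚ ≤ r → p + r ≡ q → p ≤ q
  gap {p} r 0≤r eq = subst₂ _≤_ (ℚ.+-identityʳ p) eq (ℚ.+-monoʳ-≤ p 0≤r)

  *-monoˡ : ∀ {r p q} → 0ℚ ≤ r → p ≤ q → r * p ≤ r * q
  *-monoˡ {r} 0≤r = ℚ.*-monoˡ-≤-nonNeg r {{ℚ.nonNegative 0≤r}}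

  *-monoʳ : ∀ {r p q} → 0ℚ ≤ r → p ≤ q → p * r ≤ q * r
  *-monoʳ {r} 0≤r = ℚ.*-monoʳ-≤-nonNeg r {{ℚ.nonNegative 0≤r}}

open ℚOrder public

module ℚSum where
  open import Data.Rational using (_+_; _*_; _≤_)
  open SemiringSum (CommutativeSemiring.semiring ℚ-semiring) public

  sum-mono : ∀ {n} {f g : Vector ℚ n} → (∀ i → f i ≤ g i) → sum f ≤ sum g
  sum-mono {zero}  f≤g = ℚ.≤-refl
  sum-mono {suc n} f≤g = ℚ.+-mono-≤ (f≤g zero) (sum-mono (f≤g ∘ suc))

  0≤sum : ∀ {n} {f : Vector ℚ n} → (∀ i → 0ℚ ≤ f i) → 0ℚ ≤ sum f
  0≤sum {n} {f} 0≤f = subst (_≤ sum f) (sum-replicate-zero n) (sum-mono 0≤f)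

  ι-sum : ∀ {n} (f : Vector ℕ n) → ι (ℕSum.sum f) ≡ sum (ι ∘ f)
  ι-sum {zero}  f = ι-0
  ι-sum {suc n} f = trans (ι-+ (f zero) (ℕSum.sum (f ∘ suc))) (cong (ι (f zero) ℚ.+_) (ι-sum (f ∘ suc)))

-- Rounding rational halves to half-integral ones.

module Rounding {n} (G : Graph n) where
  open import Data.Rational using (_+_; _*_; _-_; -_; _≤_; _⊓_)
  open ℚSum
  a : Fin n → Fin n → ℚ
  a u v = ι (adjacency G u v)

  a-sym : ∀ u v → a u v ≡ a v u
  a-sym u v = cong ι (adjacency-sym G u v)

  0≤a : ∀ u v → 0ℚ ≤ a u v
  0≤a u v = 0≤ι (adjacency G u v)

  a-irrefl : ∀ u → a u u ≡ 0ℚ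
  a-irrefl u = by (adj? G u u)
    where
    by : (uu? : Dec (Adj G u u)) → ι (indicator uu?) ≡ 0ℚ
    by (yes uu) = contradiction uu (irrefl G refl)
    by (no _)   = ι-0

  open BilinearForm ℚ-semiring a public
  open Kronecker ℚ-semiring
  open ℚ.≤-Reasoning

  Box : Vector ℚ n → Set
  Box x = ∀ v → 0ℚ ≤ x v × x v ≤ 1ℚ

  Integral : ℚ → Set
  Integral q = q ≡ 0ℚ ⊎ q ≡ 1ℚ

  module _ (i j : Fin n) where

    -- The exchange direction: adding `t * e` moves an amount `t` from `j` to `i`.
    e : Vector ℚ n
    e v = δ i v - δ j v

    sum-e : ∀ x → sum (λ v → e v * x v) ≡ x i - x j
    sum-e x = begin-equality
      sum (λ v → e v * x v)                                        ≡⟨ sum-cong-≗ (λ v → expand (δ i v) (δ j v) (x v)) ⟩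
      sum (λ v → δ i v * x v + (- 1ℚ) * (δ j v * x v))             ≡⟨ ∑-distrib-+ (λ v → δ i v * x v) (λ v → (- 1ℚ) * (δ j v * x v)) ⟩
      sum (λ v → δ i v * x v) + sum (λ v → (- 1ℚ) * (δ j v * x v)) ≡⟨ cong₂ _+_ (sum-δ i x) (sym (*-distribˡ-sum (- 1ℚ) (λ v → δ j v * x v))) ⟩
      x i + (- 1ℚ) * sum (λ v → δ j v * x v)                       ≡⟨ cong (λ z → x i + (- 1ℚ) * z) (sum-δ j x) ⟩
      x i + (- 1ℚ) * x j                                           ≡⟨ collapse (x i) (x j) ⟩
      x i - x j                                                    ∎
      where
      open +-*-Solver
      expand : ∀ p q r → (p - q) * r ≡ p * r + (- 1ℚ) * (q * r)
      expand = solve 3 (λ p q r → (p :- q) :* r := p :* r :+ (:- con 1ℚ) :* (q :* r)) refl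
      collapse : ∀ p q → p + (- 1ℚ) * q ≡ p - q
      collapse = solve 2 (λ p q → p :+ (:- con 1ℚ) :* q := p :- q) refl

    form-e : ∀ x → form e x ≡ row x i - row x j
    form-e x = sum-e (row x)

    row-e : ∀ u → row e u ≡ a u i - a u j
    row-e u = trans (sum-cong-≗ λ v → ℚ.*-comm (a u v) (e v)) (sum-e (a u))

    form-ee : form e e ≡ - (a i j + a j i)
    form-ee = begin-equality
      form e e                                   ≡⟨ form-e e ⟩
      row e i - row e j                          ≡⟨ cong₂ _-_ (row-e i) (row-e j) ⟩
      (a i i - a i j) - (a j i - a j j)          ≡⟨ cong₂ (λ p q → (p - a i j) - (a j i - q)) (a-irrefl i) (a-irrefl j) ⟩
      (0ℚ - a i j) - (a j i - 0ℚ)                ≡⟨ collapse (a i j) (a j i) ⟩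
      - (a i j + a j i)                          ∎
      where
      open +-*-Solver
      collapse : ∀ p q → (0ℚ - p) - (q - 0ℚ) ≡ - (p + q)
      collapse = solve 2 (λ p q → (con 0ℚ :- p) :- (q :- con 0ℚ) := :- (p :+ q)) refl

    -- Along e the form is concave, because irreflexivity kills its diagonal.
    shift-≤ : ∀ x t → 0ℚ ≤ t → row x i ≤ row x j →
              form (λ v → x v + t * e v) (λ v → x v + t * e v) ≤ form x x
    shift-≤ x t 0≤t ri≤rj = gap (t * t * (a i j + a j i) + (t * (row x j - row x i) + t * (row x j - row x i)))
      (0≤-+ (0≤-* (0≤-* 0≤t 0≤t) (0≤-+ (0≤a i j) (0≤a j i))) (0≤-+ slope slope)) (begin-equality
        form (λ v → x v + t * e v) (λ v → x v + t * e v) + R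
          ≡⟨ cong (_+ R) (form-square a-sym x (λ v → t * e v)) ⟩
        ((form x x + form te te) + (form te x + form te x)) + R
          ≡⟨ cong₂ (λ p q → ((form x x + p) + (q + q)) + R) te-te te-x ⟩
        ((form x x + t * (t * (- (a i j + a j i)))) + (t * (row x i - row x j) + t * (row x i - row x j))) + R
          ≡⟨ collapse (form x x) t (a i j + a j i) (row x i) (row x j) ⟩
        form x x ∎)
      where
      te : Vector ℚ n
      te v = t * e v
      R = t * t * (a i j + a j i) + (t * (row x j - row x i) + t * (row x j - row x i))
      slope : 0ℚ ≤ t * (row x j - row x i)
      slope = 0≤-* 0≤t (≤⇒0≤- ri≤rj)
      te-x : form te x ≡ t * (row x i - row x j)
      te-x = trans (form-*ˡ t e x) (cong (t *_) (form-e x))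
      te-te : form te te ≡ t * (t * (- (a i j + a j i)))
      te-te = trans (form-*ˡ t e te) (cong (t *_) (trans (form-comm a-sym e te)
                (trans (form-*ˡ t e e) (cong (t *_) form-ee))))
      open +-*-Solver
      collapse : ∀ f t b p q → ((f + t * (t * (- b))) + (t * (p - q) + t * (p - q)))
                               + (t * t * b + (t * (q - p) + t * (q - p))) ≡ f
      collapse = solve 5 (λ f t b p q → ((f :+ t :* (t :* (:- b))) :+ (t :* (p :- q) :+ t :* (p :- q)))
                               :+ (t :* t :* b :+ (t :* (q :- p) :+ t :* (q :- p))) := f) refl

    sum-shift : ∀ x t → sum (λ v → x v + t * e v) ≡ sum x
    sum-shift x t = begin-equality
      sum (λ v → x v + t * e v)          ≡⟨ ∑-distrib-+ x (λ v → t * e v) ⟩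
      sum x + sum (λ v → t * e v)        ≡⟨ cong (sum x ℚ.+_) (*-distribˡ-sum t e) ⟨
      sum x + t * sum e                  ≡⟨ cong (λ z → sum x + t * z) (sum-cong-≗ (λ v → ℚ.*-identityʳ (e v))) ⟨
      sum x + t * sum (λ v → e v * 1ℚ)   ≡⟨ cong (λ z → sum x + t * z) (sum-e (λ _ → 1ℚ)) ⟩
      sum x + t * (1ℚ - 1ℚ)              ≡⟨ collapse (sum x) t ⟩
      sum x                              ∎
      where
      open +-*-Solver
      collapse : ∀ s t → s + t * (1ℚ - 1ℚ) ≡ s
      collapse = solve 2 (λ s t → s :+ t :* (con 1ℚ :- con 1ℚ) := s) refl

  record Improves (x y : Vector ℚ n) : Set where
    constructor improves
    field
      box    : Box y
      total  : sum y ≡ sum x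
      form-≤ : form y y ≤ form x x

  Transfer : Fin n → Fin n → Vector ℚ n → Set
  Transfer i j x = ∃ λ y → Improves x y × (∀ v → v ≢ i → v ≢ j → y v ≡ x v) × (Integral (y i) ⊎ Integral (y j))

  push : ∀ i j x → i ≢ j → Box x → row x i ≤ row x j → Transfer i j x
  push i j x i≢j box ri≤rj =
    y , improves y-box (sum-shift i j x t) (shift-≤ i j x t 0≤t ri≤rj) , y-off , y-integral
    where
    -- The largest amount that keeps both values in the unit interval: either `i` reaches 1 or `j`
    -- reaches 0.
    t = (1ℚ - x i) ⊓ x j
    0≤t : 0ℚ ≤ t
    0≤t = ℚ.⊓-glb (≤⇒0≤- (proj₂ (box i))) (proj₁ (box j))
    y : Vector ℚ n
    y v = x v + t * e i j v
    open +-*-Solver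
    y-i : y i ≡ x i + t
    y-i = trans (cong₂ (λ p q → x i + t * (p - q)) (δ-≡ i) (δ-≢ (i≢j ∘ sym)))
            (solve 2 (λ x t → x :+ t :* (con 1ℚ :- con 0ℚ) := x :+ t) refl (x i) t)
    y-j : y j ≡ x j - t
    y-j = trans (cong₂ (λ p q → x j + t * (p - q)) (δ-≢ i≢j) (δ-≡ j))
            (solve 2 (λ x t → x :+ t :* (con 0ℚ :- con 1ℚ) := x :- t) refl (x j) t)
    y-off : ∀ v → v ≢ i → v ≢ j → y v ≡ x v
    y-off v v≢i v≢j = trans (cong₂ (λ p q → x v + t * (p - q)) (δ-≢ (v≢i ∘ sym)) (δ-≢ (v≢j ∘ sym)))
            (solve 2 (λ x t → x :+ t :* (con 0ℚ :- con 0ℚ) := x) refl (x v) t)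
    fill-up : ∀ p → p + (1ℚ - p) ≡ 1ℚ
    fill-up = solve 1 (λ p → p :+ (con 1ℚ :- p) := con 1ℚ) refl
    yi-box : 0ℚ ≤ x i + t × x i + t ≤ 1ℚ
    yi-box = 0≤-+ (proj₁ (box i)) 0≤t
           , subst (x i + t ≤_) (fill-up (x i)) (ℚ.+-monoʳ-≤ (x i) (ℚ.p⊓q≤p (1ℚ - x i) (x j)))
    yj-box : 0ℚ ≤ x j - t × x j - t ≤ 1ℚ
    yj-box = ≤⇒0≤- (ℚ.p⊓q≤q (1ℚ - x i) (x j))
           , ℚ.≤-trans (gap t 0≤t (solve 2 (λ x t → (x :- t) :+ t := x) refl (x j) t)) (proj₂ (box j))
    InUnit : ℚ → Set
    InUnit q = 0ℚ ≤ q × q ≤ 1ℚ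
    y-box : Box y
    y-box v with v Fin.≟ i | v Fin.≟ j
    ... | yes refl | _        = subst InUnit (sym y-i) yi-box
    ... | no _     | yes refl = subst InUnit (sym y-j) yj-box
    ... | no v≢i   | no v≢j   = subst InUnit (sym (y-off v v≢i v≢j)) (box v)
    y-integral : Integral (y i) ⊎ Integral (y j)
    y-integral with ℚ.≤-total (1ℚ - x i) (x j)
    ... | inj₁ le = inj₁ (inj₂ (trans y-i (trans (cong (x i ℚ.+_) (ℚ.p≤q⇒p⊓q≡p le)) (fill-up (x i)))))
    ... | inj₂ ge = inj₂ (inj₁ (trans y-j (trans (cong (λ z → x j - z) (ℚ.p≥q⇒p⊓q≡q ge)) (ℚ.+-inverseʳ (x j)))))

  Transfer-sym : ∀ {i j x} → Transfer i j x → Transfer j i x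
  Transfer-sym (y , better , off , integral) = y , better , (λ v v≢j v≢i → off v v≢i v≢j) , Sum.swap integral

  -- The vertex with the smaller row receives: in that direction the slope of the form is not
  -- positive, and one of the two directions always qualifies.
  transfer : ∀ i j x → i ≢ j → Box x → Transfer i j x
  transfer i j x i≢j box = [ push i j x i≢j box , (λ ge → Transfer-sym (push j i x (i≢j ∘ sym) box ge)) ]′
    (ℚ.≤-total (row x i) (row x j))

  Improves-trans : ∀ {x y z} → Improves x y → Improves y z → Improves x z
  Improves-trans (improves _ Σy fy) (improves box Σz fz) = improves box (trans Σz Σy) (ℚ.≤-trans fz fy)

  -- An exchange with the carry c makes c or the next vertex integral; in the former case the
  -- next vertex becomes the new carry.
  sweep : ∀ j → j ℕ.≤ n → Fin n → ∀ x → Box x →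
    ∃ λ y → Improves x y × ∃ λ c → ∀ v → toℕ v ℕ.< j → v ≢ c → Integral (y v)
  sweep zero    _   c x box = x , improves box refl ℚ.≤-refl , c , λ _ ()
  sweep (suc j) j<n c₀ x box with sweep j (ℕ.<⇒≤ j<n) c₀ x box
  ... | y , better , c , integral = by (c Fin.≟ w)
    where
    w = fromℕ< j<n
    before : ∀ v → toℕ v ℕ.< suc j → v ≢ w → toℕ v ℕ.< j
    before v v<1+j v≢w = ℕ.≤∧≢⇒< (ℕ.≤-pred v<1+j)
      λ v≡j → v≢w (Fin.toℕ-injective (trans v≡j (sym (Fin.toℕ-fromℕ< j<n))))
    by : Dec (c ≡ w) → ∃ λ z → Improves x z × ∃ λ c → ∀ v → toℕ v ℕ.< suc j → v ≢ c → Integral (z v)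
    by (yes c≡w) = y , better , c , λ v v< v≢c →
      integral v (before v v< (λ v≡w → v≢c (trans v≡w (sym c≡w)))) v≢c
    by (no c≢w) = advance (transfer c w y c≢w (Improves.box better))
      where
      advance : Transfer c w y → ∃ λ z → Improves x z × ∃ λ c → ∀ v → toℕ v ℕ.< suc j → v ≢ c → Integral (z v)
      advance (z , better′ , off , done) = z , Improves-trans better better′ , carry done
        where
        old : ∀ v → toℕ v ℕ.< suc j → v ≢ c → v ≢ w → Integral (z v)
        old v v< v≢c v≢w = subst Integral (sym (off v v≢c v≢w)) (integral v (before v v< v≢w) v≢c)
        carry : Integral (z c) ⊎ Integral (z w) → ∃ λ c → ∀ v → toℕ v ℕ.< suc j → v ≢ c → Integral (z v)
        carry (inj₁ zc) = w , λ v v< v≢w → case-c v v< v≢w (v Fin.≟ c)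
          where
          case-c : ∀ v → toℕ v ℕ.< suc j → v ≢ w → Dec (v ≡ c) → Integral (z v)
          case-c v v< v≢w (yes refl) = zc
          case-c v v< v≢w (no v≢c)   = old v v< v≢c v≢w
        carry (inj₂ zw) = c , λ v v< v≢c → case-w v v< v≢c (v Fin.≟ w)
          where
          case-w : ∀ v → toℕ v ℕ.< suc j → v ≢ c → Dec (v ≡ w) → Integral (z v)
          case-w v v< v≢c (yes refl) = zw
          case-w v v< v≢c (no v≢w)   = old v v< v≢c v≢w

  halved : Vector ℕ n → Vector ℚ n
  halved f v = ½ * ι (f v)

  HalfIntegral : Vector ℕ n → Set
  HalfIntegral f = (∀ v → f v ℕ.≤ 2) × ℕSum.sum f ≡ n

  sum-halved : ∀ f → sum (halved f) ≡ ½ * ι (ℕSum.sum f)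
  sum-halved f = trans (sym (*-distribˡ-sum ½ (ι ∘ f))) (cong (½ *_) (sym (ι-sum f)))

  ½ι-cancel : ∀ {k l} → ½ * ι k ≤ ½ * ι l → k ℕ.≤ l
  ½ι-cancel le = ι-cancel (ℚ.*-cancelˡ-≤-pos ½ le)

  -- The exceptional value is forced by the total: `n / 2` minus a sum of zeros and ones is half an
  -- integer, and the box confines its double `r` to 0, 1, 2.
  half-integral : ∀ x c → Box x → sum x ≡ ½ * ι n → (∀ v → v ≢ c → Integral (x v)) →
    ∃ λ f → HalfIntegral f × ∀ v → x v ≡ halved f v
  half-integral x c box Σx integral = f , (f≤2 , Σf) , x≡½f
    where
    module δℕ = Kronecker ℕ.+-*-commutativeSemiring
    base : ∀ v → ∃ λ k → k ℕ.≤ 2 × ((v ≡ c × k ≡ 0) ⊎ (v ≢ c × x v ≡ ½ * ι k))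
    base v with v Fin.≟ c
    -- A placeholder at `c`; the value `r` is added there once the sum `F` of the others is known.
    ... | yes v≡c = 0 , z≤n , inj₁ (v≡c , refl)
    ... | no v≢c with integral v v≢c
    ...   | inj₁ x≡0 = 0 , z≤n , inj₂ (v≢c , trans x≡0 (sym (trans (cong (½ *_) ι-0) (ℚ.*-zeroʳ ½))))
    ...   | inj₂ x≡1 = 2 , ℕ.≤-refl , inj₂ (v≢c , trans x≡1 (sym ½*2))
    f₀ : Vector ℕ n
    f₀ v = proj₁ (base v)
    F = ℕSum.sum f₀
    split : ∀ v → x v ≡ halved f₀ v + δ c v * x v
    split v = by (proj₂ (proj₂ (base v)))
      where
      by : (v ≡ c × f₀ v ≡ 0) ⊎ (v ≢ c × x v ≡ halved f₀ v) → x v ≡ halved f₀ v + δ c v * x v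
      by (inj₁ (refl , f₀≡0)) rewrite f₀≡0 | ι-0 | δ-≡ v =
        sym (trans (ℚ.+-identityˡ (1ℚ * x v)) (ℚ.*-identityˡ (x v)))
      by (inj₂ (v≢c , x≡)) rewrite δ-≢ (v≢c ∘ sym) =
        trans x≡ (sym (trans (cong (halved f₀ v ℚ.+_) (ℚ.*-zeroˡ (x v))) (ℚ.+-identityʳ _)))
    total : ½ * ι F + x c ≡ ½ * ι n
    total = begin-equality
      ½ * ι F + x c                                      ≡⟨ cong₂ _+_ (sum-halved f₀) (sum-δ c x) ⟨
      sum (halved f₀) + sum (λ v → δ c v * x v)          ≡⟨ ∑-distrib-+ (halved f₀) (λ v → δ c v * x v) ⟨
      sum (λ v → halved f₀ v + δ c v * x v)              ≡⟨ sum-cong-≗ split ⟨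
      sum x                                              ≡⟨ Σx ⟩
      ½ * ι n                                            ∎
    F≤n : F ℕ.≤ n
    F≤n = ½ι-cancel (gap (x c) (proj₁ (box c)) total)
    n≤F+2 : n ℕ.≤ F ℕ.+ 2
    n≤F+2 = ½ι-cancel (begin
      ½ * ι n                  ≡⟨ total ⟨
      ½ * ι F + x c            ≤⟨ ℚ.+-monoʳ-≤ (½ * ι F) (proj₂ (box c)) ⟩
      ½ * ι F + 1ℚ             ≡⟨ cong (½ * ι F ℚ.+_) ½*2 ⟨
      ½ * ι F + ½ * ι 2        ≡⟨ ℚ.*-distribˡ-+ ½ (ι F) (ι 2) ⟨
      ½ * (ι F + ι 2)          ≡⟨ cong (½ *_) (ι-+ F 2) ⟨
      ½ * ι (F ℕ.+ 2)          ∎)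
    r = n ℕ.∸ F
    x-c : x c ≡ ½ * ι r
    x-c = begin-equality
      x c                                ≡⟨ cancel (½ * ι F) (x c) ⟩
      (½ * ι F + x c) - ½ * ι F          ≡⟨ cong (_- ½ * ι F) (trans total (trans (cong (λ k → ½ * ι k) (sym (ℕ.m+[n∸m]≡n F≤n))) (cong (½ *_) (ι-+ F r)))) ⟩
      ½ * (ι F + ι r) - ½ * ι F          ≡⟨ cancel′ (ι F) (ι r) ⟩
      ½ * ι r                            ∎
      where
      open +-*-Solver
      cancel : ∀ p q → q ≡ (p + q) - p
      cancel = solve 2 (λ p q → q := (p :+ q) :- p) refl
      cancel′ : ∀ p q → ½ * (p + q) - ½ * p ≡ ½ * q
      cancel′ = solve 2 (λ p q → con ½ :* (p :+ q) :- con ½ :* p := con ½ :* q) refl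
    f : Vector ℕ n
    f v = f₀ v ℕ.+ δℕ.δ c v ℕ.* r
    Σf : ℕSum.sum f ≡ n
    Σf = trans (ℕSum.∑-distrib-+ f₀ (λ v → δℕ.δ c v ℕ.* r))
      (trans (cong (F ℕ.+_) (δℕ.sum-δ c (λ _ → r))) (ℕ.m+[n∸m]≡n F≤n))
    value : ∀ v → (v ≡ c × f v ≡ r) ⊎ (v ≢ c × f v ≡ f₀ v × x v ≡ halved f₀ v)
    value v = by (proj₂ (proj₂ (base v)))
      where
      by : (v ≡ c × f₀ v ≡ 0) ⊎ (v ≢ c × x v ≡ halved f₀ v) →
           (v ≡ c × f v ≡ r) ⊎ (v ≢ c × f v ≡ f₀ v × x v ≡ halved f₀ v)
      by (inj₁ (refl , f₀≡0)) = inj₁ (refl , cong₂ ℕ._+_ f₀≡0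
        (trans (cong (ℕ._* r) (δℕ.δ-≡ v)) (ℕ.*-identityˡ r)))
      by (inj₂ (v≢c , x≡)) = inj₂ (v≢c , trans (cong (f₀ v ℕ.+_)
        (cong (ℕ._* r) (δℕ.δ-≢ (v≢c ∘ sym)))) (ℕ.+-identityʳ (f₀ v)) , x≡)
    f≤2 : ∀ v → f v ℕ.≤ 2
    f≤2 v = [ (λ (_ , f≡r) → subst (ℕ._≤ 2) (sym f≡r) (ℕ.m≤n+o⇒m∸n≤o n F n≤F+2))
            , (λ (_ , f≡f₀ , _) → subst (ℕ._≤ 2) (sym f≡f₀) (proj₁ (proj₂ (base v)))) ]′ (value v)
    x≡½f : ∀ v → x v ≡ halved f v
    x≡½f v = [ (λ { (refl , f≡r) → trans x-c (cong (λ k → ½ * ι k) (sym f≡r)) })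
             , (λ (_ , f≡f₀ , x≡) → trans x≡ (cong (λ k → ½ * ι k) (sym f≡f₀))) ]′ (value v)

  -- A sweep through all `n` vertices leaves at most one fractional value, which `half-integral`
  -- settles. `c₀` supplies the initial carry.
  round : Fin n → ∀ x → Box x → sum x ≡ ½ * ι n →
    ∃ λ f → HalfIntegral f × form (halved f) (halved f) ≤ form x x
  round c₀ x box Σx with sweep n ℕ.≤-refl c₀ x box
  ... | y , improves y-box Σy y≤x , c , integral
    with half-integral y c y-box (trans Σy Σx) (λ v → integral v (Fin.toℕ<n v))
  ...   | f , half , y≡½f = f , half , ℚ.≤-trans (ℚ.≤-reflexive (sym (form-cong y≡½f y≡½f))) y≤x

  private module ℕForm = BilinearForm ℕ.+-*-commutativeSemiring (adjacency G)

  ι-row : ∀ f u → ι (ℕForm.row f u) ≡ row (ι ∘ f) u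
  ι-row f u = trans (ι-sum (λ v → adjacency G u v ℕ.* f v))
    (sum-cong-≗ {n} {λ v → ι (adjacency G u v ℕ.* f v)} λ v → ι-* (adjacency G u v) (f v))

  ι-form : ∀ f → ι (ℕForm.form f f) ≡ form (ι ∘ f) (ι ∘ f)
  ι-form f = trans (ι-sum (λ u → f u ℕ.* ℕForm.row f u))
    (sum-cong-≗ {n} {λ u → ι (f u ℕ.* ℕForm.row f u)} λ u →
      trans (ι-* (f u) (ℕForm.row f u)) (cong (ι (f u) *_) (ι-row f u)))

  form-halved : ∀ f → form (halved f) (halved f) ≡ ½ * (½ * ι (ℕForm.form f f))
  form-halved f = begin-equality
    form (halved f) (halved f)       ≡⟨ form-*ˡ ½ (ι ∘ f) (halved f) ⟩
    ½ * form (ι ∘ f) (halved f)      ≡⟨ cong (½ *_) (form-comm a-sym (ι ∘ f) (halved f)) ⟩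
    ½ * form (halved f) (ι ∘ f)      ≡⟨ cong (½ *_) (form-*ˡ ½ (ι ∘ f) (ι ∘ f)) ⟩
    ½ * (½ * form (ι ∘ f) (ι ∘ f))   ≡⟨ cong (λ z → ½ * (½ * z)) (ι-form f) ⟨
    ½ * (½ * ι (ℕForm.form f f))     ∎

  edgeSumℚ : Vector ℚ n → ℚ
  edgeSumℚ x = sum λ u → sum λ v → if does (u Fin.<? v ×-dec adj? G u v) then x u * x v else 0ℚ

  -- Adding the sum with its indices swapped, each ordered adjacent pair is selected by exactly one
  -- of `u < v` and `v < u`; the diagonal is excluded by irreflexivity.
  double-edgeSum : ∀ x → edgeSumℚ x + edgeSumℚ x ≡ form x x
  double-edgeSum x = begin-equality
    edgeSumℚ x + edgeSumℚ x
      ≡⟨ cong (edgeSumℚ x ℚ.+_) (∑-comm E) ⟩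
    sum (λ u → sum λ v → E u v) + sum (λ u → sum λ v → E v u)
      ≡⟨ ∑-distrib-+ (λ u → sum λ v → E u v) (λ u → sum λ v → E v u) ⟨
    sum (λ u → sum (λ v → E u v) + sum (λ v → E v u))
      ≡⟨ sum-cong-≗ (λ u → trans (sym (∑-distrib-+ (λ v → E u v) (λ v → E v u)))
           (trans (sum-cong-≗ λ v → pair u v (u Fin.<? v) (v Fin.<? u) (adj? G u v) (adj? G v u))
             (sym (*-distribˡ-sum (x u) (λ v → a u v * x v))))) ⟩
    form x x ∎
    where
    E : Fin n → Fin n → ℚ
    E u v = if does (u Fin.<? v ×-dec adj? G u v) then x u * x v else 0ℚ
    pair : ∀ u v (p : Dec (u Fin.< v)) (q : Dec (v Fin.< u)) (r : Dec (Adj G u v)) (s : Dec (Adj G v u)) →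
      (if does (p ×-dec r) then x u * x v else 0ℚ) + (if does (q ×-dec s) then x v * x u else 0ℚ)
      ≡ x u * (ι (indicator r) * x v)
    pair u v (yes u<v) (yes v<u) _ _ = contradiction v<u (ℕ.<-asym u<v)
    pair u v p q (yes uv) (no ¬vu) = contradiction (symm G uv) ¬vu
    pair u v p q (no ¬uv) (yes vu) = contradiction (symm G vu) ¬uv
    pair u v (no u≮v) (no v≮u) (yes uv) (yes _) =
      contradiction uv (irrefl G (Fin.toℕ-injective (ℕ.≤-antisym (ℕ.≮⇒≥ v≮u) (ℕ.≮⇒≥ u≮v))))
    pair u v (yes _) (no _) (yes _) (yes _) = trans (ℚ.+-identityʳ (x u * x v))
      (cong (x u *_) (sym (trans (cong (_* x v) ι-1) (ℚ.*-identityˡ (x v)))))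
    pair u v (no _) (yes _) (yes _) (yes _) = trans (ℚ.+-identityˡ (x v * x u)) (trans (ℚ.*-comm (x v) (x u))
      (cong (x u *_) (sym (trans (cong (_* x v) ι-1) (ℚ.*-identityˡ (x v))))))
    pair u v p q (no _) (no _) = trans (trivial (does p) (does q))
      (sym (trans (cong (x u *_) (trans (cong (_* x v) ι-0) (ℚ.*-zeroˡ (x v)))) (ℚ.*-zeroʳ (x u))))
      where
      trivial : ∀ b c {y z : ℚ} → (if b ∧ false then y else 0ℚ) + (if c ∧ false then z else 0ℚ) ≡ 0ℚ
      trivial true  true  = refl
      trivial true  false = refl
      trivial false true  = refl
      trivial false false = refl

-- Eventual properties and the order of Cauchy reals.

Eventually : (ℕ → Set) → Set
Eventually P = ∃ λ N → ∀ m → N ℕ.≤ m → P m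

Eventually-× : ∀ {P Q} → Eventually P → Eventually Q → Eventually (λ m → P m × Q m)
Eventually-× (M , p) (N , q) = M ℕ.⊔ N , λ m M⊔N≤m →
  p m (ℕ.m⊔n≤o⇒m≤o M N M⊔N≤m) , q m (ℕ.m⊔n≤o⇒n≤o M N M⊔N≤m)

Eventually-∀ : ∀ {n} {P : Fin n → ℕ → Set} → (∀ i → Eventually (P i)) → Eventually (λ m → ∀ i → P i m)
Eventually-∀ {zero}  ev = 0 , λ _ _ ()
Eventually-∀ {suc n} ev with Eventually-× (ev zero) (Eventually-∀ (ev ∘ suc))
... | N , holds = N , λ m N≤m → λ { zero → proj₁ (holds m N≤m) ; (suc i) → proj₂ (holds m N≤m) i }

module _ where
  open import Data.Rational using (_+_; _*_; _≤_; _<_)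

  0<*½ : ∀ {ε} → 0ℚ < ε → 0ℚ < ε * ½
  0<*½ {ε} 0<ε = ℚ.positive⁻¹ _ {{ℚ.pos*pos⇒pos ε {{ℚ.positive 0<ε}} ½}}

  ½+½ : ∀ ε → ε * ½ + ε * ½ ≡ ε
  ½+½ ε = trans (sym (ℚ.*-distribˡ-+ ε ½ ½)) (ℚ.*-identityʳ ε)

  ≤⇒≤ᴿ : ∀ x y → (∀ m → seq x m ≤ seq y m) → x ≤ᴿ y
  ≤⇒≤ᴿ x y x≤y ε 0<ε = 0 , λ m _ →
    ℚ.≤-trans (x≤y m) (gap ε (ℚ.<⇒≤ 0<ε) refl)

  ≤ᴿ-trans : ∀ x y z → x ≤ᴿ y → y ≤ᴿ z → x ≤ᴿ z
  ≤ᴿ-trans x y z x≤y y≤z ε 0<ε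
    with Eventually-× (x≤y (ε * ½) (0<*½ 0<ε)) (y≤z (ε * ½) (0<*½ 0<ε))
  ... | N , holds = N , λ m N≤m → ℚ.≤-trans (proj₁ (holds m N≤m))
    (ℚ.≤-trans (ℚ.+-monoˡ-≤ (ε * ½) (proj₂ (holds m N≤m)))
      (ℚ.≤-reflexive (trans (ℚ.+-assoc (seq z m) (ε * ½) (ε * ½)) (cong (seq z m ℚ.+_) (½+½ ε)))))

  ℚ-inverse : ∀ B → 0ℚ < B → ∃ λ r → 0ℚ < r × B * r ≡ 1ℚ
  ℚ-inverse B 0<B = r , ℚ.positive⁻¹ r {{ℚ.1/pos⇒pos B {{B>0}}}} , ℚ.*-inverseʳ B {{nz}}
    where
    B>0 = ℚ.positive 0<B
    nz  = ℚ.pos⇒nonZero B {{B>0}}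
    r   = (ℚ.1/ B) {{nz}}

  -- The choice is `δ = ε / (ε + K)`: the summand `ε` in the denominator yields `δ ≤ 1` and also
  -- covers `K = 0`.
  small : ∀ K ε → 0ℚ ≤ K → 0ℚ < ε → ∃ λ δ → 0ℚ < δ × δ ≤ 1ℚ × K * δ ≤ ε
  small K ε 0≤K 0<ε with ℚ-inverse (ε + K) (ℚ.+-mono-<-≤ 0<ε 0≤K)
  ... | r , 0<r , Br≡1 = ε * r , 0<δ , δ≤1 , Kδ≤ε
    where
    0<δ : 0ℚ < ε * r
    0<δ = ℚ.positive⁻¹ _ {{ℚ.pos*pos⇒pos ε {{ℚ.positive 0<ε}} r {{ℚ.positive 0<r}}}}
    open +-*-Solver
    δ≤1 : ε * r ≤ 1ℚ
    δ≤1 = gap (K * r) (0≤-* 0≤K (ℚ.<⇒≤ 0<r)) (trans (sym (ℚ.*-distribʳ-+ r ε K)) Br≡1)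
    Kδ≤ε : K * (ε * r) ≤ ε
    Kδ≤ε = gap (ε * (ε * r)) (0≤-* (ℚ.<⇒≤ 0<ε) (ℚ.<⇒≤ 0<δ))
      (trans (solve 3 (λ K ε r → K :* (ε :* r) :+ ε :* (ε :* r) := ε :* ((ε :+ K) :* r)) refl K ε r)
        (trans (cong (ε *_) Br≡1) (ℚ.*-identityʳ ε)))

-- The minimum over doubled halves, and its stability under small errors.

module _ {n} (G : Graph n) where
  open import Data.Rational using (_+_; _*_; _-_; -_; _≤_; _<_)
  open ℚSum
  open Rounding G
  open ℚ.≤-Reasoning

  cost : Vector ℕ n → ℚ
  cost f = form (halved f) (halved f)

  decode : Fin (3 ℕ.^ n) → Vector ℕ n
  decode code v = toℕ (finToFun code v)

  decode≤2 : ∀ code v → decode code v ℕ.≤ 2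
  decode≤2 code v = ℕ.≤-pred (Fin.toℕ<n (finToFun code v))

  encode : ∀ f → (∀ v → f v ℕ.≤ 2) → ∃ λ code → decode code ≗ f
  encode f f≤2 = funToFin g , λ v →
    trans (cong toℕ (Fin.finToFun-funToFin g v)) (Fin.toℕ-fromℕ< (s≤s (f≤2 v)))
    where
    g : Fin n → Fin 3
    g v = fromℕ< (s≤s (f≤2 v))

  -- Vectors with values 0, 1, 2 are coded by the numbers below `3 ^ n`, so they can be listed,
  -- filtered by total and searched. The given vector starts the search, which guarantees that the
  -- result has the right total.
  minimal : ∃ HalfIntegral → ∃ λ f → HalfIntegral f × ∀ g → HalfIntegral g → cost f ≤ cost g
  minimal (f , f≤2 , Σf) = decode best , (decode≤2 best , best-total) , below
    where
    Total : Fin (3 ℕ.^ n) → Set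
    Total code = ℕSum.sum (decode code) ≡ n
    total? : ∀ code → Dec (Total code)
    total? code = ℕSum.sum (decode code) ℕ.≟ n
    candidates = filter total? (allFin (3 ℕ.^ n))
    first = proj₁ (encode f f≤2)
    best = argmin (cost ∘ decode) first candidates
    best-total : Total best
    best-total = argmin-all (cost ∘ decode) {P = Total}
      (trans (ℕSum.sum-cong-≗ (proj₂ (encode f f≤2))) Σf) (all-filter total? (allFin (3 ℕ.^ n)))
    below : ∀ g → HalfIntegral g → cost (decode best) ≤ cost g
    below g (g≤2 , Σg) with encode g g≤2
    ... | code , code≗g = ℚ.≤-trans
      (All.lookup (f[argmin]≤f[xs] first candidates)
        (∈-filter⁺ total? (∈-allFin code) (trans (ℕSum.sum-cong-≗ code≗g) Σg)))
      (ℚ.≤-reflexive (form-cong same same))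
      where
      same : ∀ v → halved (decode code) v ≡ halved g v
      same v = cong (λ k → ½ * ι k) (code≗g v)

  𝟙 : Vector ℚ n
  𝟙 _ = 1ℚ

  K : ℚ
  K = form 𝟙 𝟙

  0≤row : ∀ {x} → (∀ v → 0ℚ ≤ x v) → ∀ u → 0ℚ ≤ row x u
  0≤row 0≤x u = 0≤sum λ v → 0≤-* (0≤ι (adjacency G u v)) (0≤x v)

  0≤form : ∀ {x y} → (∀ v → 0ℚ ≤ x v) → (∀ v → 0ℚ ≤ y v) → 0ℚ ≤ form x y
  0≤form 0≤x 0≤y = 0≤sum λ u → 0≤-* (0≤x u) (0≤row 0≤y u)

  0≤𝟙 : ∀ v → 0ℚ ≤ 𝟙 v
  0≤𝟙 _ = ℚ.nonNegative⁻¹ 1ℚ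

  sum-const : ∀ k c → sum {k} (λ _ → c) ≡ ι k * c
  sum-const zero    c = sym (trans (cong (_* c) ι-0) (ℚ.*-zeroˡ c))
  sum-const (suc k) c = begin-equality
    c + sum {k} (λ _ → c)     ≡⟨ cong₂ _+_ (sym (ℚ.*-identityˡ c)) (sum-const k c) ⟩
    1ℚ * c + ι k * c          ≡⟨ cong (λ z → z * c + ι k * c) ι-1 ⟨
    ι 1 * c + ι k * c         ≡⟨ ℚ.*-distribʳ-+ c (ι 1) (ι k) ⟨
    (ι 1 + ι k) * c           ≡⟨ cong (_* c) (ι-+ 1 k) ⟨
    ι (suc k) * c             ∎

  module _ .{{_ : NonZero n}} {best : ℚ}
    (best-≤ : ∀ x → Box x → sum x ≡ ½ * ι n → best ≤ form x x)
    (y : Vector ℚ n) {δ : ℚ} (0<δ : 0ℚ < δ) (δ≤1 : δ ≤ 1ℚ)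
    (y-lower : ∀ v → 0ℚ ≤ y v + δ) (y-upper : ∀ v → y v ≤ 1ℚ + δ)
    (Σ-lower : ½ * ι n ≤ sum y + δ) (Σ-upper : sum y ≤ ½ * ι n + δ) where

    private
      0≤δ = ℚ.<⇒≤ 0<δ
      4δ = δ + δ + (δ + δ)
      -- The raised vector `yc` stays below `1 + δ + 3 δ`, so division by `D` brings it back into
      -- the box.
      D = 1ℚ + 4δ
      0≤4δ : 0ℚ ≤ 4δ
      0≤4δ = 0≤-+ (0≤-+ 0≤δ 0≤δ) (0≤-+ 0≤δ 0≤δ)
      inv = ℚ-inverse D (ℚ.+-mono-<-≤ (ℚ.positive⁻¹ 1ℚ) 0≤4δ)
      r = proj₁ inv
      0≤r = ℚ.<⇒≤ (proj₁ (proj₂ inv))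
      Dr≡1 : D * r ≡ 1ℚ
      Dr≡1 = proj₂ (proj₂ inv)
      s = ½ * ι n - sum y
      t = + 1 / n
      tn≡1 : t * ι n ≡ 1ℚ
      tn≡1 = trans (/-*-ι 1 n) ι-1
      0≤t : 0ℚ ≤ t
      0≤t = ℚ.nonNegative⁻¹ t {{ℚ.normalize-nonNeg 1 n}}
      t≤1 : t ≤ 1ℚ
      t≤1 = subst₂ _≤_ (trans (cong (t *_) ι-1) (ℚ.*-identityʳ t)) tn≡1
        (*-monoˡ 0≤t (ι-mono (ℕ.>-nonZero⁻¹ n)))
      -- Chosen so that the raised total is `n / 2 + 2 δ n = D * (n / 2)`: the term `s / n` corrects
      -- the sum, and `2 δ` puts `c` between `δ` and `3 δ`, enough to lift every value above 0.
      c = δ + δ + s * t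

      open +-*-Solver

      0≤s+δ : 0ℚ ≤ s + δ
      0≤s+δ = subst (0ℚ ≤_)
        (solve 3 (λ h y d → (h :+ d) :- y := (h :- y) :+ d) refl (½ * ι n) (sum y) δ) (≤⇒0≤- Σ-upper)

      0≤δ-s : 0ℚ ≤ δ - s
      0≤δ-s = subst (0ℚ ≤_)
        (solve 3 (λ h y d → (y :+ d) :- h := d :- (h :- y)) refl (½ * ι n) (sum y) δ) (≤⇒0≤- Σ-lower)

      δ≤c : δ ≤ c
      δ≤c = gap ((s + δ) * t + δ * (1ℚ - t)) (0≤-+ (0≤-* 0≤s+δ 0≤t) (0≤-* 0≤δ (≤⇒0≤- t≤1)))
        (solve 3 (λ d s t → d :+ ((s :+ d) :* t :+ d :* (con 1ℚ :- t)) := d :+ d :+ s :* t) refl δ s t)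

      c≤3δ : c ≤ δ + δ + δ
      c≤3δ = gap ((δ - s) * t + δ * (1ℚ - t)) (0≤-+ (0≤-* 0≤δ-s 0≤t) (0≤-* 0≤δ (≤⇒0≤- t≤1)))
        (solve 3 (λ d s t → (d :+ d :+ s :* t) :+ ((d :- s) :* t :+ d :* (con 1ℚ :- t)) := d :+ d :+ d) refl δ s t)

      0≤c : 0ℚ ≤ c
      0≤c = ℚ.≤-trans 0≤δ δ≤c

      yc z : Vector ℚ n
      yc v = y v + c * 𝟙 v
      z v = r * yc v

      0≤yc : ∀ v → 0ℚ ≤ yc v
      0≤yc v = subst (0ℚ ≤_)
        (solve 3 (λ y d c → (y :+ d) :+ (c :- d) := y :+ c :* con 1ℚ) refl (y v) δ c)
        (0≤-+ (y-lower v) (≤⇒0≤- δ≤c))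

      yc≤D : ∀ v → yc v ≤ D
      yc≤D v = gap ((1ℚ + δ - y v) + ((δ + δ + δ) - c)) (0≤-+ (≤⇒0≤- (y-upper v)) (≤⇒0≤- c≤3δ))
        (solve 3 (λ y d c → (y :+ c :* con 1ℚ) :+ ((con 1ℚ :+ d :- y) :+ ((d :+ d :+ d) :- c))
                            := con 1ℚ :+ (d :+ d :+ (d :+ d))) refl (y v) δ c)

      rD≡1 : r * D ≡ 1ℚ
      rD≡1 = trans (ℚ.*-comm r D) Dr≡1

      r≤1 : r ≤ 1ℚ
      r≤1 = gap (r * 4δ) (0≤-* 0≤r 0≤4δ)
        (trans (solve 2 (λ r d → r :+ r :* d := r :* (con 1ℚ :+ d)) refl r 4δ) rD≡1)

      z-box : Box z
      z-box v = 0≤-* 0≤r (0≤yc v) , subst (z v ≤_) rD≡1 (*-monoˡ 0≤r (yc≤D v))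

      Σz : sum z ≡ ½ * ι n
      Σz = begin-equality
        sum z                                      ≡⟨ *-distribˡ-sum r yc ⟨
        r * sum yc                                 ≡⟨ cong (r *_) (∑-distrib-+ y (λ _ → c * 1ℚ)) ⟩
        r * (sum y + sum {n} (λ _ → c * 1ℚ))       ≡⟨ cong (λ q → r * (sum y + q)) (sum-const n (c * 1ℚ)) ⟩
        r * (sum y + ι n * (c * 1ℚ))
          ≡⟨ solve 5 (λ r y N d t → r :* (y :+ N :* ((d :+ d :+ (con ½ :* N :- y) :* t) :* con 1ℚ))
               := r :* (y :+ (con ½ :* N :- y) :* (t :* N) :+ (d :+ d) :* N)) refl r (sum y) (ι n) δ t ⟩
        r * (sum y + s * (t * ι n) + (δ + δ) * ι n) ≡⟨ cong (λ q → r * (sum y + s * q + (δ + δ) * ι n)) tn≡1 ⟩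
        r * (sum y + s * 1ℚ + (δ + δ) * ι n)
          ≡⟨ solve 4 (λ r y N d → r :* (y :+ (con ½ :* N :- y) :* con 1ℚ :+ (d :+ d) :* N)
               := (r :* (con 1ℚ :+ (d :+ d :+ (d :+ d)))) :* (con ½ :* N)) refl r (sum y) (ι n) δ ⟩
        r * D * (½ * ι n)                          ≡⟨ cong (_* (½ * ι n)) rD≡1 ⟩
        1ℚ * (½ * ι n)                             ≡⟨ ℚ.*-identityˡ (½ * ι n) ⟩
        ½ * ι n                                    ∎

      contract : ∀ {q} → 0ℚ ≤ q → r * q ≤ q
      contract {q} 0≤q = subst (r * q ≤_) (ℚ.*-identityˡ q) (*-monoʳ 0≤q r≤1)

      form-z : form z z ≤ form yc yc
      form-z = begin
        form z z                 ≡⟨ form-*ˡ r yc z ⟩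
        r * form yc z            ≤⟨ contract (0≤form 0≤yc (λ v → proj₁ (z-box v))) ⟩
        form yc z                ≡⟨ form-comm a-sym yc z ⟩
        form z yc                ≡⟨ form-*ˡ r yc yc ⟩
        r * form yc yc           ≤⟨ contract (0≤form 0≤yc 0≤yc) ⟩
        form yc yc               ∎

      c𝟙 : Vector ℚ n
      c𝟙 v = c * 𝟙 v

      0≤K : 0ℚ ≤ K
      0≤K = 0≤form 0≤𝟙 0≤𝟙

      form-c𝟙-c𝟙 : form c𝟙 c𝟙 ≡ c * (c * K)
      form-c𝟙-c𝟙 = trans (form-*ˡ c 𝟙 c𝟙) (cong (c *_) (trans (form-comm a-sym 𝟙 c𝟙) (form-*ˡ c 𝟙 𝟙)))

      form-c𝟙-y : form c𝟙 y ≤ c * (K + K)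
      form-c𝟙-y = begin
        form c𝟙 y             ≡⟨ form-*ˡ c 𝟙 y ⟩
        -- Here `y v ≤ 1 + δ ≤ 2`, so `y` may be replaced by `𝟙 + 𝟙`.
        c * form 𝟙 y          ≤⟨ *-monoˡ 0≤c (sum-mono λ u → *-monoˡ (0≤𝟙 u) (sum-mono λ v →
                                   *-monoˡ (0≤ι (adjacency G u v)) (ℚ.≤-trans (y-upper v) (ℚ.+-monoʳ-≤ 1ℚ δ≤1)))) ⟩
        c * form 𝟙 (λ v → 𝟙 v + 𝟙 v) ≡⟨ cong (c *_) (form-+ʳ 𝟙 𝟙 𝟙) ⟩
        c * (K + K)           ∎

      -- The raise adds at most `c (c + 4) K`, and `c ≤ 3 δ ≤ 3` bounds this by `3 δ * 7 * K`.
      21ℚ = + 21 / 1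

      form-yc : form yc yc ≤ form y y + 21ℚ * K * δ
      form-yc = begin
        form yc yc
          ≡⟨ form-square a-sym y c𝟙 ⟩
        form y y + form c𝟙 c𝟙 + (form c𝟙 y + form c𝟙 y)
          ≤⟨ ℚ.+-mono-≤ (ℚ.≤-reflexive (cong (form y y ℚ.+_) form-c𝟙-c𝟙)) (ℚ.+-mono-≤ form-c𝟙-y form-c𝟙-y) ⟩
        form y y + c * (c * K) + (c * (K + K) + c * (K + K))
          ≡⟨ solve 3 (λ f c k → f :+ c :* (c :* k) :+ (c :* (k :+ k) :+ c :* (k :+ k))
                              := f :+ c :* ((c :+ con (+ 4 / 1)) :* k)) refl (form y y) c K ⟩
        form y y + c * ((c + + 4 / 1) * K)
          ≤⟨ ℚ.+-monoʳ-≤ (form y y) (*-monoʳ (0≤-* (0≤-+ 0≤c (ℚ.nonNegative⁻¹ (+ 4 / 1))) 0≤K) c≤3δ) ⟩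
        form y y + (δ + δ + δ) * ((c + + 4 / 1) * K)
          ≤⟨ ℚ.+-monoʳ-≤ (form y y) (*-monoˡ (0≤-+ (0≤-+ 0≤δ 0≤δ) 0≤δ) (*-monoʳ 0≤K (ℚ.+-monoˡ-≤ (+ 4 / 1)
               (ℚ.≤-trans c≤3δ (ℚ.+-mono-≤ (ℚ.+-mono-≤ δ≤1 δ≤1) δ≤1))))) ⟩
        form y y + (δ + δ + δ) * ((1ℚ + 1ℚ + 1ℚ + + 4 / 1) * K)
          ≡⟨ solve 3 (λ f d k → f :+ (d :+ d :+ d) :* ((con 1ℚ :+ con 1ℚ :+ con 1ℚ :+ con (+ 4 / 1)) :* k)
                              := f :+ con (+ 21 / 1) :* k :* d) refl (form y y) δ K ⟩
        form y y + 21ℚ * K * δ ∎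

    -- `y` satisfies the constraints of a half up to `δ`. The vector `z`, which is `y` raised by `c`
    -- and divided by `D`, satisfies them exactly; the division does not increase the form, and the
    -- raise costs at most the error term.
    approximate : best ≤ form y y + 21ℚ * K * δ
    approximate = ℚ.≤-trans (best-≤ z z-box Σz) (ℚ.≤-trans form-z form-yc)

-- Real halves and their weights.

/-≤-/ : ∀ k l d .{{_ : NonZero d}} → + k / d ℚ.≤ + l / d → k ℕ.≤ l
/-≤-/ k l d le = ι-cancel (subst₂ ℚ._≤_ (/-*-ι k d) (/-*-ι l d) (*-monoʳ (0≤ι d) le))

module _ {n} (G : Graph n) .{{_ : NonZero n}} where
  open import Data.Rational using (_+_; _*_; _-_; -_; _≤_; _<_)
  open ℚSum
  open Rounding G
  open ℚ.≤-Reasoning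

  private
    w : ℚ
    w = (+ 1 / (n ℕ.* n)) {{ℕ.m*n≢0 n n}}

    w-n² : w * ι (n ℕ.* n) ≡ 1ℚ
    w-n² = trans (/-*-ι 1 (n ℕ.* n) {{ℕ.m*n≢0 n n}}) ι-1

    0≤w : 0ℚ ≤ w
    0≤w = ℚ.nonNegative⁻¹ w {{ℚ.normalize-nonNeg 1 (n ℕ.* n) {{ℕ.m*n≢0 n n}}}}

    w≤1 : w ≤ 1ℚ
    w≤1 = subst₂ _≤_ (trans (cong (w *_) ι-1) (ℚ.*-identityʳ w)) w-n²
      (*-monoˡ 0≤w (ι-mono (ℕ.>-nonZero⁻¹ (n ℕ.* n) {{ℕ.m*n≢0 n n}})))

    open +-*-Solver

  at : Vector ℝ n → ℕ → Vector ℚ n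
  at μ m v = seq (μ v) m

  seq-sumᴿ : ∀ {k} (f : Vector ℝ k) m → seq (sumᴿ f) m ≡ sum (λ i → seq (f i) m)
  seq-sumᴿ {zero}  f m = refl
  seq-sumᴿ {suc k} f m = cong (seq (f zero) m ℚ.+_) (seq-sumᴿ (f ∘ suc) m)

  seq-weight : ∀ μ m → seq (weight G μ) m ≡ w * edgeSumℚ (at μ m)
  seq-weight μ m = cong (w *_) (trans (seq-sumᴿ row-sum m) (sum-cong-≗ λ u →
    trans (seq-sumᴿ (entry u) m) (sum-cong-≗ λ v →
      seq-if (does (u Fin.<? v ×-dec adj? G u v)) (μ u *ᴿ μ v))))
    where
    entry : Fin n → Fin n → ℝ
    entry u v = if does (u Fin.<? v ×-dec adj? G u v) then μ u *ᴿ μ v else fromℚ 0ℚ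
    row-sum : Fin n → ℝ
    row-sum u = sumᴿ (entry u)
    seq-if : ∀ b p → seq (if b then p else fromℚ 0ℚ) m ≡ (if b then seq p m else 0ℚ)
    seq-if true  p = refl
    seq-if false p = refl

  n/2 : + n / 2 ≡ ½ * ι n
  n/2 = begin-equality
    + n / 2                  ≡⟨ solve 1 (λ q → q := con ½ :* (q :* con (+ 2 / 1))) refl (+ n / 2) ⟩
    ½ * (+ n / 2 * (+ 2 / 1)) ≡⟨ cong (λ z → ½ * (+ n / 2 * z)) (ι-/1 2) ⟨
    ½ * (+ n / 2 * ι 2)      ≡⟨ cong (½ *_) (/-*-ι n 2) ⟩
    ½ * ι n                  ∎

  realHalf : Vector ℕ n → Vector ℝ n
  realHalf f v = fromℚ (halved f v)

  realHalf-isHalf : ∀ f → HalfIntegral f → IsHalf (realHalf f)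
  realHalf-isHalf f (f≤2 , Σf) = record
    { nonneg = λ v → ≤⇒≤ᴿ (fromℚ 0ℚ) (realHalf f v) λ _ → 0≤-* (ℚ.nonNegative⁻¹ ½) (0≤ι (f v))
    ; ≤one   = λ v → ≤⇒≤ᴿ (realHalf f v) (fromℚ 1ℚ) λ _ → ≤1 v
    ; total  = ≤⇒≤ᴿ (sumᴿ (realHalf f)) (fromℚ (+ n / 2)) (λ m → ℚ.≤-reflexive (Σ≡ m))
             , ≤⇒≤ᴿ (fromℚ (+ n / 2)) (sumᴿ (realHalf f)) (λ m → ℚ.≤-reflexive (sym (Σ≡ m)))
    }
    where
    ≤1 : ∀ v → halved f v ≤ 1ℚ
    ≤1 v = subst (halved f v ≤_) ½*2 (*-monoˡ (ℚ.nonNegative⁻¹ ½) (ι-mono (f≤2 v)))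
    Σ≡ : ∀ m → seq (sumᴿ (realHalf f)) m ≡ + n / 2
    Σ≡ m = trans (seq-sumᴿ (realHalf f) m)
      (trans (sum-halved f) (trans (cong (λ k → ½ * ι k) Σf) (sym n/2)))

  -- Far enough along the Cauchy sequences, the rational approximations of `μ` satisfy all the
  -- constraints of a half up to `δ`. Then `approximate` applies, with `δ` chosen so that its error
  -- term is at most `ε`.
  weight-minimal : ∀ f → (∀ g → HalfIntegral g → cost G f ≤ cost G g) →
    ∀ μ → IsHalf μ → weight G (realHalf f) ≤ᴿ weight G μ
  weight-minimal f f-minimal μ half ε 0<ε = limit (small (+ 21 / 1 * K G) ε
      (0≤-* (ℚ.nonNegative⁻¹ (+ 21 / 1)) (0≤form G (0≤𝟙 G) (0≤𝟙 G))) 0<ε)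
    where
    open IsHalf half

    best-≤ : ∀ x → Box x → sum x ≡ ½ * ι n → cost G f ≤ form x x
    best-≤ x box Σx with round (fromℕ< (ℕ.>-nonZero⁻¹ n)) x box Σx
    ... | g , g-half , g≤x = ℚ.≤-trans (f-minimal g g-half) g≤x

    ½-cancel : ∀ {p q} → p + p ≤ q + q → p ≤ q
    ½-cancel {p} {q} le = ℚ.*-cancelˡ-≤-pos (+ 2 / 1) (subst₂ _≤_ (double p) (double q) le)
      where
      double : ∀ p → p + p ≡ + 2 / 1 * p
      double = solve 1 (λ p → p :+ p := con (+ 2 / 1) :* p) refl

    compare : ∀ y → cost G f ≤ form y y + ε → w * edgeSumℚ (halved f) ≤ w * edgeSumℚ y + ε
    compare y le = begin
      w * edgeSumℚ (halved f)      ≤⟨ *-monoˡ 0≤w (½-cancel (begin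
        edgeSumℚ (halved f) + edgeSumℚ (halved f) ≡⟨ double-edgeSum (halved f) ⟩
        cost G f                                  ≤⟨ le ⟩
        -- Enlarging the error to `2 ε` lets the factor 2 between form and edge sum cancel.
        form y y + ε                              ≤⟨ gap ε (ℚ.<⇒≤ 0<ε) refl ⟩
        form y y + ε + ε                          ≡⟨ cong (λ z → z + ε + ε) (double-edgeSum y) ⟨
        edgeSumℚ y + edgeSumℚ y + ε + ε           ≡⟨ solve 2 (λ p e → p :+ p :+ e :+ e := (p :+ e) :+ (p :+ e)) refl (edgeSumℚ y) ε ⟩
        edgeSumℚ y + ε + (edgeSumℚ y + ε)         ∎)) ⟩
      w * (edgeSumℚ y + ε)         ≡⟨ ℚ.*-distribˡ-+ w (edgeSumℚ y) ε ⟩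
      w * edgeSumℚ y + w * ε       ≤⟨ ℚ.+-monoʳ-≤ (w * edgeSumℚ y) (*-monoʳ (ℚ.<⇒≤ 0<ε) w≤1) ⟩
      w * edgeSumℚ y + 1ℚ * ε      ≡⟨ cong (w * edgeSumℚ y ℚ.+_) (ℚ.*-identityˡ ε) ⟩
      w * edgeSumℚ y + ε           ∎

    limit : (∃ λ δ → 0ℚ < δ × δ ≤ 1ℚ × + 21 / 1 * K G * δ ≤ ε) →
      Eventually λ m → seq (weight G (realHalf f)) m ≤ seq (weight G μ) m + ε
    limit (δ , 0<δ , δ≤1 , Kδ≤ε) = proj₁ eventually , λ m N≤m → at-index m (proj₂ eventually m N≤m)
      where
      Close : ℕ → Set
      Close m = ((∀ v → 0ℚ ≤ seq (μ v) m + δ) × (∀ v → seq (μ v) m ≤ 1ℚ + δ))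
              × (seq (sumᴿ μ) m ≤ + n / 2 + δ × + n / 2 ≤ seq (sumᴿ μ) m + δ)
      eventually : Eventually Close
      eventually = Eventually-×
        (Eventually-× (Eventually-∀ λ v → nonneg v δ 0<δ) (Eventually-∀ λ v → ≤one v δ 0<δ))
        (Eventually-× (proj₁ total δ 0<δ) (proj₂ total δ 0<δ))
      at-index : ∀ m → Close m → seq (weight G (realHalf f)) m ≤ seq (weight G μ) m + ε
      at-index m ((lower , upper) , Σ≤ , Σ≥) = subst₂ (λ p q → p ≤ q + ε)
        (sym (seq-weight (realHalf f) m)) (sym (seq-weight μ m))
        (compare (at μ m) (ℚ.≤-trans
          (approximate G best-≤ (at μ m) 0<δ δ≤1 lower upper
            (subst₂ (λ h s → h ≤ s + δ) n/2 (seq-sumᴿ μ m) Σ≥)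
            (subst₂ (λ s h → s ≤ h + δ) (seq-sumᴿ μ m) n/2 Σ≤))
          (ℚ.+-monoʳ-≤ (form (at μ m) (at μ m)) Kδ≤ε)))

  weight-bound : ∀ f g → cost G f ≤ cost G g →
    25 ℕ.* BilinearForm.form ℕ.+-*-commutativeSemiring (adjacency G) g g ℕ.≤ 4 ℕ.* (n ℕ.* n) →
    weight G (realHalf f) ≤ᴿ fromℚ (+ 1 / 50)
  weight-bound f g f≤g 25F≤4n² = ≤⇒≤ᴿ (weight G (realHalf f)) (fromℚ (+ 1 / 50)) λ m →
    ℚ.≤-trans (ℚ.≤-reflexive (seq-weight (realHalf f) m)) (begin
      w * E                          ≤⟨ *-monoˡ 0≤w E≤ ⟩
      w * (+ 1 / 50 * N)             ≡⟨ solve 2 (λ w N → w :* (con (+ 1 / 50) :* N) := con (+ 1 / 50) :* (w :* N)) refl w N ⟩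
      + 1 / 50 * (w * N)             ≡⟨ cong (+ 1 / 50 *_) w-n² ⟩
      + 1 / 50 * 1ℚ                  ≡⟨ ℚ.*-identityʳ (+ 1 / 50) ⟩
      + 1 / 50                       ∎)
    where
    E = edgeSumℚ (halved f)
    F = BilinearForm.form ℕ.+-*-commutativeSemiring (adjacency G) g g
    N = ι (n ℕ.* n)
    25F≤4N : + 25 / 1 * ι F ≤ + 4 / 1 * N
    25F≤4N = subst₂ _≤_ (trans (ι-* 25 F) (cong (_* ι F) (ι-/1 25)))
      (trans (ι-* 4 (n ℕ.* n)) (cong (_* N) (ι-/1 4))) (ι-mono 25F≤4n²)
    E≤ : E ≤ + 1 / 50 * N
    E≤ = begin
      E                                    ≡⟨ solve 1 (λ e → e := con ½ :* (e :+ e)) refl E ⟩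
      ½ * (E + E)                          ≡⟨ cong (½ *_) (double-edgeSum (halved f)) ⟩
      ½ * cost G f                         ≤⟨ *-monoˡ (ℚ.nonNegative⁻¹ ½) f≤g ⟩
      ½ * cost G g                         ≡⟨ cong (½ *_) (form-halved g) ⟩
      -- The constant `1 / 200` is `1 / 8` times `1 / 25`: the eighth from doubled values and double
      -- counting, the rest to match `25 F ≤ 4 n²`.
      ½ * (½ * (½ * ι F))                  ≡⟨ solve 1 (λ x → con ½ :* (con ½ :* (con ½ :* x)) := con (+ 1 / 200) :* (con (+ 25 / 1) :* x)) refl (ι F) ⟩
      + 1 / 200 * (+ 25 / 1 * ι F)         ≤⟨ *-monoˡ (ℚ.nonNegative⁻¹ (+ 1 / 200)) 25F≤4N ⟩
      + 1 / 200 * (+ 4 / 1 * N)            ≡⟨ solve 1 (λ x → con (+ 1 / 200) :* (con (+ 4 / 1) :* x) := con (+ 1 / 50) :* x) refl N ⟩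
      + 1 / 50 * N                         ∎

  2n≤5k : ∀ k → + k / n ≥ + 2 / 5 → 2 ℕ.* n ℕ.≤ 5 ℕ.* k
  2n≤5k k 2/5≤ = ι-cancel (begin
    ι (2 ℕ.* n)               ≡⟨ ι-* 2 n ⟩
    ι 2 * ι n                 ≡⟨ cong (_* ι n) (/-*-ι 2 5) ⟨
    + 2 / 5 * ι 5 * ι n       ≤⟨ *-monoʳ (0≤ι n) (*-monoʳ (0≤ι 5) 2/5≤) ⟩
    + k / n * ι 5 * ι n       ≡⟨ solve 3 (λ q x y → q :* x :* y := x :* (q :* y)) refl (+ k / n) (ι 5) (ι n) ⟩
    ι 5 * (+ k / n * ι n)     ≡⟨ cong (ι 5 *_) (/-*-ι k n) ⟩
    ι 5 * ι k                 ≡⟨ ι-* 5 k ⟨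
    ι (5 ℕ.* k)               ∎)

corollary3p7 : ∀ (n : ℕ) .{{_ : NonZero n}} (G : Graph n) → TriangleFree G →
    ∀ (α : ℚ) → IsRelIndependenceNumber G α → α ≥ + 2 / 5 →
    ∃ λ (β : ℝ) → IsMinHalfDensity G β × β ≤ᴿ fromℚ (+ 1 / 50)
corollary3p7 n G triangle-free α ((A , A-independent , refl) , α-maximum) α≥2/5 =
  conclude (SparseHalf.sparse-half G triangle-free A A-independent
    -- The ratios share the denominator `n`, so the maximal ratio makes `A` largest among
    -- independent sets.
    (λ S S-independent → /-≤-/ (∣ S ∣) (∣ A ∣) n (α-maximum _ (S , S-independent , refl)))
    (ℕ.>-nonZero⁻¹ n) (2n≤5k G (∣ A ∣) α≥2/5))
  where
  open Rounding G using (HalfIntegral)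
  conclude : (∃ λ g → (∀ v → g v ℕ.≤ 2) × ℕSum.sum g ≡ n ×
                25 ℕ.* BilinearForm.form ℕ.+-*-commutativeSemiring (adjacency G) g g ℕ.≤ 4 ℕ.* (n ℕ.* n)) →
             ∃ λ β → IsMinHalfDensity G β × β ≤ᴿ fromℚ (+ 1 / 50)
  conclude (g , g≤2 , Σg , sparse) = finish (minimal G (g , g≤2 , Σg))
    where
    finish : (∃ λ f → HalfIntegral f × ∀ g → HalfIntegral g → cost G f ℚ.≤ cost G g) →
             ∃ λ β → IsMinHalfDensity G β × β ≤ᴿ fromℚ (+ 1 / 50)
    finish (f , f-half , f-minimal) = β
      , ((realHalf G f , realHalf-isHalf G f f-half , β≤β , β≤β) , below)
      , weight-bound G f g (f-minimal g (g≤2 , Σg)) sparse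
      where
      β = weight G (realHalf G f)
      β≤β = ≤⇒≤ᴿ β β λ _ → ℚ.≤-refl
      below : ∀ x → (∃ λ μ → IsHalf μ × x ≈ᴿ weight G μ) → β ≤ᴿ x
      -- A competitor `x` agrees with the weight of `μ` only as a real number, so the bound is
      -- carried over by one half of that equality.
      below x (μ , half , _ , w≤x) =
        ≤ᴿ-trans β (weight G μ) x (weight-minimal G f f-minimal μ half) w≤x
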